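{- Let $G$ be a graph with no isolated vertices. Then $p(G)\leq 2$, where $p(G)$ denotes the $P$-vertex covering number of $G$.
   Context: Graphs are finite, simple and undirected; a graph on $n\ge 1$ vertices has vertex set $[n]=\{1,\ldots,n\}$. For a real symmetric $n\times n$ matrix $A=(a_{ij})$, its support graph $G(A)$ is the graph with vertex set $[n]$ and edge set $\{\{i,j\}: i\neq j,\ a_{ij}\neq 0\}$ (diagonal entries play no role). For a graph $G$ on $n$ vertices, $S(G)=\{A\in\mathbb{R}^{n\times n}: A^{T}=A,\ G(A)=G\}$. For $i\in[n]$, $A(i)$ denotes the principal submatrix of $A$ obtained by deleting the $i$-th row and the $i$-th column. $m_A(\lambda)$ denotes the algebraic multiplicity of $\lambda$ as an eigenvalue of $A$ (equal to $0$ if $\lambda$ is not an eigenvalue). A vertex $i$ of $G$ is called a $P$-vertex of $A\in S(G)$ if $m_{A(i)}(0)-m_A(0)=1$. The $P$-vertex covering number $p(G)$ is the minimum cardinality $|\mathcal{A}|$ of a family $\mathcal{A}\subseteq S(G)$ of non-singular matrices such that every vertex of $G$ is a $P$-vertex of some $A\in\mathcal{A}$; if no such family exists, $p(G)=\infty$. -}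

module Defs where

open import Level using (0ℓ; _⊔_)
open import Algebra.Bundles using (RawRing; CommutativeRing)
import Algebra.Definitions.RawSemiring as RawSemiringDefinitions
open import Axiom.ExcludedMiddle using (ExcludedMiddle) public
open import Data.Bool.Base using (if_then_else_)
open import Data.Fin.Base using (Fin; zero; suc; toℕ; punchIn)
open import Data.Fin.Properties using (_≟_)
open import Data.List.Base using (List; []; _∷_; map)
open import Data.Nat.Base as ℕ using (ℕ; zero; suc)
open import Data.Product.Base using (Σ-syntax; ∃; ∃-syntax; _×_; _,_)
open import Data.Vec.Functional using (Vector)
open import Function.Base using (_∘_)
open import Function.Bundles using (_⇔_)
open import Function.Definitions using (Injective)
open import Relation.Binary.Core using (Rel)
open import Relation.Binary.Definitions using (Symmetric; Irreflexive)
open import Relation.Binary.PropositionalEquality.Core as ≡ using (_≡_; _≢_)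
open import Relation.Binary.Structures using (IsTotalOrder)
open import Relation.Nullary using (¬_; does)
open import Relation.Nullary.Construct.Add.Supremum using (_⁺; [_]; ⊤⁺) public
open import Relation.Binary.Construct.Add.Supremum.NonStrict ℕ._≤_ using (_≤⁺_) public
open import Relation.Unary using (Pred; Satisfiable)

-- ℝ is axiomatised as a Dedekind-complete ordered field, which determines it
-- up to isomorphism. The axioms are classical: they are to be used together
-- with excluded middle, under which the Cauchy sequences of rationals are a
-- model.

record CompleteOrderedField : Set₁ where
  infix 4 _≤_
  field
    commutativeRing : CommutativeRing 0ℓ 0ℓ

  open CommutativeRing commutativeRing public

  field
    _≤_          : Rel Carrier 0ℓ
    isTotalOrder : IsTotalOrder _≈_ _≤_
    +-monoʳ-≤    : ∀ x {y z} → y ≤ z → x + y ≤ x + z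
    *-nonNeg     : ∀ {x y} → 0# ≤ x → 0# ≤ y → 0# ≤ x * y
    1≉0          : 1# ≉ 0#
    inverse      : ∀ x → x ≉ 0# → ∃[ y ] x * y ≈ 1#

  IsUpperBound : Pred Carrier 0ℓ → Carrier → Set
  IsUpperBound P u = ∀ x → P x → x ≤ u

  field
    complete : ∀ (P : Pred Carrier 0ℓ) → Satisfiable P → ∃ (IsUpperBound P) →
               ∃[ s ] IsUpperBound P s × (∀ u → IsUpperBound P u → s ≤ u)

module Polynomial {c ℓ} (R : RawRing c ℓ) where
  open RawRing R

  -- Coefficients, lowest degree first; trailing zeros are allowed.
  Poly : Set c
  Poly = List Carrier

  coeff : Poly → ℕ → Carrier
  coeff []      _       = 0#
  coeff (a ∷ p) zero    = a
  coeff (a ∷ p) (suc k) = coeff p k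

  infix 4 _≈ₚ_
  _≈ₚ_ : Rel Poly ℓ
  p ≈ₚ q = ∀ k → coeff p k ≈ coeff q k

  infixl 6 _+ₚ_
  _+ₚ_ : Poly → Poly → Poly
  []      +ₚ q       = q
  (a ∷ p) +ₚ []      = a ∷ p
  (a ∷ p) +ₚ (b ∷ q) = (a + b) ∷ (p +ₚ q)

  infixl 7 _*ₚ_
  _*ₚ_ : Poly → Poly → Poly
  []      *ₚ q = []
  (a ∷ p) *ₚ q = map (a *_) q +ₚ (0# ∷ (p *ₚ q))

  constant : Carrier → Poly
  constant a = a ∷ []

  X : Poly
  X = 0# ∷ 1# ∷ []

  polyRawRing : RawRing c ℓ
  polyRawRing = record
    { Carrier = Poly
    ; _≈_     = _≈ₚ_
    ; _+_     = _+ₚ_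
    ; _*_     = _*ₚ_
    ; -_      = map (-_)
    ; 0#      = []
    ; 1#      = constant 1#
    }

  open RawRing polyRawRing using () renaming (rawSemiring to polyRawSemiring; -_ to -ₚ_)
  open RawSemiringDefinitions polyRawSemiring using (_^_; _∣_)

  -- The multiplicity of a as a root of p; no k qualifies when p is zero.
  IsRootMultiplicity : Poly → Carrier → ℕ → Set (c ⊔ ℓ)
  IsRootMultiplicity p a k = (L ^ k) ∣ p × ¬ (L ^ suc k) ∣ p
    where
    L : Poly
    L = X +ₚ (-ₚ constant a)

SquareMatrix : ∀ {c} → Set c → ℕ → Set c
SquareMatrix A n = Fin n → Fin n → A

-- A ⟨ i ⟩ deletes the i-th row and the i-th column.
infix 8 _⟨_⟩
_⟨_⟩ : ∀ {c} {A : Set c} {n} → SquareMatrix A (suc n) → Fin (suc n) → SquareMatrix A n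
(A ⟨ i ⟩) j k = A (punchIn i j) (punchIn i k)

module Determinant {c ℓ} (R : RawRing c ℓ) where
  open RawRing R
  open RawSemiringDefinitions rawSemiring using (_^_; sum)

  -- Laplace expansion along the first row.
  det : ∀ {n} → SquareMatrix Carrier n → Carrier
  det {zero}  A = 1#
  det {suc n} A =
    sum λ j → ((- 1#) ^ toℕ j) * (A zero j * det λ r s → A (suc r) (punchIn j s))

module CharacteristicPolynomial {c ℓ} (R : RawRing c ℓ) where
  open RawRing R
  open Polynomial R
  open RawRing polyRawRing using () renaming (-_ to -ₚ_; 0# to 0ₚ)

  charPoly : ∀ {n} → SquareMatrix Carrier n → Poly
  charPoly A = Determinant.det polyRawRing λ i j →
    (if does (i ≟ j) then X else 0ₚ) +ₚ (-ₚ constant (A i j))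

  IsAlgebraicMultiplicity : ∀ {n} → SquareMatrix Carrier n → Carrier → ℕ → Set (c ⊔ ℓ)
  IsAlgebraicMultiplicity A = IsRootMultiplicity (charPoly A)

record Graph (n : ℕ) : Set₁ where
  field
    Adj    : Rel (Fin n) 0ℓ
    sym    : Symmetric Adj
    irrefl : Irreflexive _≡_ Adj

open Graph public using (Adj)

SameEdges : ∀ {n} → Rel (Graph n) 0ℓ
SameEdges G H = ∀ i j → Adj G i j ⇔ Adj H i j

NoIsolatedVertices : ∀ {n} → Graph n → Set
NoIsolatedVertices G = ∀ i → ∃[ j ] Adj G i j

module _ (ℝ : CompleteOrderedField) where
  open CompleteOrderedField ℝ
  open Determinant rawRing using (det)
  open CharacteristicPolynomial rawRing using (IsAlgebraicMultiplicity)

  Matrix : ℕ → Set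
  Matrix = SquareMatrix Carrier

  infix 4 _≈ₘ_
  _≈ₘ_ : ∀ {n} → Rel (Matrix n) 0ℓ
  A ≈ₘ B = ∀ i j → A i j ≈ B i j

  IsSymmetric : ∀ {n} → Matrix n → Set
  IsSymmetric A = ∀ i j → A j i ≈ A i j

  supportGraph : ∀ {n} (A : Matrix n) → IsSymmetric A → Graph n
  supportGraph A A-sym = record
    { Adj    = λ i j → i ≢ j × A i j ≉ 0#
    ; sym    = λ { {i} {j} (i≢j , aij≉0) →
                 i≢j ∘ ≡.sym , λ aji≈0 → aij≉0 (trans (A-sym j i) aji≈0) }
    ; irrefl = λ { i≡j (i≢j , _) → i≢j i≡j }
    }

  S : ∀ {n} → Graph n → Pred (Matrix n) 0ℓ
  S G A = Σ[ A-sym ∈ IsSymmetric A ] SameEdges (supportGraph A A-sym) G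

  NonSingular : ∀ {n} → Matrix n → Set
  NonSingular A = det A ≉ 0#

  IsPVertex : ∀ {n} → Matrix (suc n) → Fin (suc n) → Set
  IsPVertex A i = ∃[ k ] ∃[ l ]
    IsAlgebraicMultiplicity (A ⟨ i ⟩) 0# k × IsAlgebraicMultiplicity A 0# l × k ≡ l ℕ.+ 1

  -- Injectivity makes k the cardinality of the family.
  record IsPVertexCover {n} (G : Graph (suc n)) {k : ℕ}
                        (𝒜 : Vector (Matrix (suc n)) k) : Set where
    field
      distinct    : Injective _≡_ _≈ₘ_ 𝒜
      inS         : ∀ a → S G (𝒜 a)
      nonSingular : ∀ a → NonSingular (𝒜 a)
      covers      : ∀ i → ∃[ a ] IsPVertex (𝒜 a) i

  HasPVertexCover : ∀ {n} → Graph (suc n) → ℕ → Set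
  HasPVertexCover {n} G k = Σ[ 𝒜 ∈ Vector (Matrix (suc n)) k ] IsPVertexCover G 𝒜

  -- The value p(G) lies in ℕ ∪ {∞}. Only finite families are considered: as
  -- there are finitely many vertices, any cover contains a finite one.
  IsPVertexCoveringNumber : ∀ {n} → Graph (suc n) → ℕ ⁺ → Set
  IsPVertexCoveringNumber G [ k ] = HasPVertexCover G k × (∀ l → HasPVertexCover G l → k ℕ.≤ l)
  IsPVertexCoveringNumber G ⊤⁺    = ∀ l → ¬ HasPVertexCover G l

{-# OPTIONS --safe #-}
module Submission where

-- If A is symmetric and invertible and (A⁻¹)ᵢᵢ = 0, then i is a P-vertex of A.
--
-- Colour a maximal independent set of G and its complement differently. Every
-- vertex then has a neighbour of the other colour, so it suffices to find, for
-- either colour class U, a matrix in S(G) whose inverse has zero diagonal on U.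
-- Choosing a neighbour p(u) ∉ U of each u ∈ U gives a spanning forest of stars,
-- and the inverse of the form Σ_{u∈U} (x_u + x_{p(u)})² − Σ_{w∉U} x_w² has zero
-- diagonal on U. Add ε times the adjacency matrix of G and replace the weight 1
-- of each leaf u by 1 + ε s_u. Requiring that the inverse still have zero diagonal
-- on U leads to an equation z = ε Ψ(z) with Ψ polynomial.
--
-- For small ε it is solved using suprema only. With a Lipschitz constant M of Ψ,
-- g(x , y) = ε (Ψ(x) + M (Σx − Σy)) increases in x and decreases in y, so Tarski's
-- theorem yields an extremal pair with x = g(x , y) and y = g(y , x), for which
-- contraction forces x = y.

open import Defs
open import Level using (0ℓ; _⊔_)
open import Algebra.Bundles using (AbelianGroup; CommutativeRing; RawRing)
import Algebra.Construct.DirectProduct as DirectProduct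
import Algebra.Definitions.RawMagma as RawMagmaDefinitions
import Algebra.Definitions.RawSemiring as RawSemiringDefinitions
import Algebra.Properties.Ring as RingProperties
import Algebra.Properties.Semiring.Exp as SemiringExp
import Algebra.Properties.Semiring.Mult as SemiringMult
import Algebra.Properties.Semiring.Mult.TCOptimised as SemiringMult′
import Algebra.Properties.Semiring.Sum as SemiringSum
import Algebra.Solver.Ring as RingSolver
open import Algebra.Solver.Ring.AlmostCommutativeRing
  using (fromCommutativeRing; _-Raw-AlmostCommutative⟶_)
open import Data.Bool.Base using (Bool; true; false; not; if_then_else_)
open import Data.Bool.Properties using (not-involutive; ¬-not)
open import Data.Fin.Base
  using (Fin; zero; suc; toℕ; punchIn; punchOut; pinch; combine; quotient; remainder)
open import Data.Fin.Properties
  using (_≟_; punchIn-injective; punchInᵢ≢i; punchIn-punchOut; remQuot-combine)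
open import Data.List.Base using ([]; _∷_; map)
open import Data.Maybe.Base using (Maybe; just; nothing)
open import Data.Nat.Base as ℕ using (ℕ; zero; suc; z≤n; s≤s)
import Data.Nat.Properties as ℕ
open import Data.Product.Base using (_×_; _,_; proj₁; proj₂; ∃-syntax; Σ-syntax)
open import Data.Sum.Base using (inj₁; inj₂)
open import Data.Vec.Functional using (Vector; updateAt)
open import Data.Vec.Functional.Properties using (updateAt-updates; updateAt-minimal)
open import Function.Base using (const; _∘_)
open import Function.Bundles using (mk⇔)
open import Relation.Binary.Bundles using (Poset; Setoid)
import Relation.Binary.Construct.Add.Supremum.NonStrict ℕ._≤_ as ≤⁺
open import Relation.Binary.Core using (Rel)
open import Relation.Binary.Definitions using (Symmetric; Irreflexive)
open import Relation.Binary.PropositionalEquality.Core as ≡ using (_≡_; _≢_)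
import Relation.Binary.Reasoning.PartialOrder as PosetReasoning
import Relation.Binary.Reasoning.Setoid as SetoidReasoning
open import Relation.Binary.Structures using (IsTotalOrder)
open import Relation.Nullary using (¬_; Dec; yes; no; does; contradiction)
open import Relation.Nullary.Decidable using (decidable-stable)

-- The star form alone has the right inverse but the wrong support: its matrix sees only the star
-- edges. Adding ε times the adjacency matrix repairs the support and spoils the zeros of the
-- inverse, so one free weight is kept for each zero that must be restored.
--
-- The unperturbed zero at a leaf u is a cancellation 1 - 1: the inverse entry is the value of a
-- diagonal form with entries 1 at u and -1 at p(u) on the isotropic vector e_u - e_p(u). To first
-- order, the weight s_u shifts this entry by -ε s_u and leaves the entries at the other leaves
-- alone. The conditions can therefore be solved for the weights, as in the implicit function
-- theorem; since the reals are given by suprema, an order-theoretic fixed point takes its place.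
--
-- For P-vertices, det A(i) = det A · (A⁻¹)ᵢᵢ shows that 0 becomes a root. That the root is simple
-- comes from symmetry: the next coefficient involves (A⁻²)ᵢᵢ, a sum of squares. Only two
-- coefficients of the characteristic polynomial matter, so it is read modulo X², that is, over the
-- dual numbers.

-- Coefficients are formal differences (a , b) = a − b of natural numbers, so
-- that the solver can cancel terms in an arbitrary commutative ring.
module IntegerCoefficientSolver {c ℓ} (R : CommutativeRing c ℓ) where
  open CommutativeRing R
  open RingProperties ring
  open SemiringMult semiring renaming (_×_ to _·_) using (×-homo-+; ×1-homo-*; ×-congˡ)
  open SemiringMult′ semiring using (×ᵤ≈×) renaming (_×_ to _·′_)
  open SetoidReasoning setoid

  private
    Difference : RawRing 0ℓ 0ℓ
    Difference = record
      { Carrier = ℕ × ℕ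
      ; _≈_     = _≡_
      ; _+_     = λ (a , b) (a′ , b′) → a ℕ.+ a′ , b ℕ.+ b′
      ; _*_     = λ (a , b) (a′ , b′) → a ℕ.* a′ ℕ.+ b ℕ.* b′ , a ℕ.* b′ ℕ.+ b ℕ.* a′
      ; -_      = λ (a , b) → b , a
      ; 0#      = 0 , 0
      ; 1#      = 1 , 0
      }

    -- Common successors are cancelled and the optimised multiple `_·′_` is used, so that (0 , 0)
    -- and (1 , 0) evaluate to `0#` and `1#` definitionally; `⟦⟧≈` recovers the uniform description
    -- as a difference.
    ⟦_⟧ : ℕ × ℕ → Carrier
    ⟦ a     , zero ⟧  = a ·′ 1#
    ⟦ zero  , suc b ⟧ = - (suc b ·′ 1#)
    ⟦ suc a , suc b ⟧ = ⟦ a , b ⟧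

    ι : ℕ → Carrier
    ι a = a · 1#

    open import Algebra.Solver.CommutativeMonoid +-commutativeMonoid
      using () renaming (solve to solve⁺; _⊕_ to _:⊕_; _⊜_ to _:≜_)

    ⟦⟧≈ : ∀ x → ⟦ x ⟧ ≈ ι (proj₁ x) - ι (proj₂ x)
    ⟦⟧≈ (a , zero)  = sym (begin
      ι a - 0#   ≈⟨ +-congˡ -0#≈0# ⟩
      ι a + 0#   ≈⟨ +-identityʳ _ ⟩
      ι a        ≈⟨ ×ᵤ≈× a 1# ⟩
      a ·′ 1#    ∎)
    ⟦⟧≈ (zero , suc b) = sym (begin
      0# - ι (suc b)       ≈⟨ +-identityˡ _ ⟩
      - ι (suc b)          ≈⟨ -‿cong (×ᵤ≈× (suc b) 1#) ⟩
      - (suc b ·′ 1#)      ∎)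
    ⟦⟧≈ (suc a , suc b) = begin
      ⟦ a , b ⟧                      ≈⟨ ⟦⟧≈ (a , b) ⟩
      ι a - ι b                      ≈⟨ +-identityˡ _ ⟨
      0# + (ι a - ι b)               ≈⟨ +-congʳ (-‿inverseʳ 1#) ⟨
      (1# - 1#) + (ι a - ι b)        ≈⟨ solve⁺ 4 (λ a b c d → (a :⊕ b) :⊕ (c :⊕ d) :≜ (a :⊕ c) :⊕ (b :⊕ d))
           refl _ _ _ _ ⟩
      (1# + ι a) + (- 1# + - ι b)    ≈⟨ +-congˡ (-‿+-comm _ _) ⟩
      ι (suc a) - ι (suc b)          ∎

    +-homo : ∀ x y → ⟦ RawRing._+_ Difference x y ⟧ ≈ ⟦ x ⟧ + ⟦ y ⟧
    +-homo x@(a , b) y@(a′ , b′) = begin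
      ⟦ a ℕ.+ a′ , b ℕ.+ b′ ⟧             ≈⟨ ⟦⟧≈ (a ℕ.+ a′ , b ℕ.+ b′) ⟩
      ι (a ℕ.+ a′) - ι (b ℕ.+ b′)         ≈⟨ +-cong (×-homo-+ 1# a a′) (-‿cong (×-homo-+ 1# b b′)) ⟩
      (ι a + ι a′) - (ι b + ι b′)         ≈⟨ +-congˡ (-‿+-comm _ _) ⟨
      (ι a + ι a′) + (- ι b + - ι b′)     ≈⟨ solve⁺ 4 (λ a b c d → (a :⊕ c) :⊕ (b :⊕ d) :≜ (a :⊕ b) :⊕ (c :⊕ d))
           refl _ _ _ _ ⟩
      (ι a - ι b) + (ι a′ - ι b′)         ≈⟨ +-cong (⟦⟧≈ x) (⟦⟧≈ y) ⟨
      ⟦ x ⟧ + ⟦ y ⟧                       ∎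

    *-homo : ∀ x y → ⟦ RawRing._*_ Difference x y ⟧ ≈ ⟦ x ⟧ * ⟦ y ⟧
    *-homo x@(a , b) y@(a′ , b′) = begin
      ⟦ a ℕ.* a′ ℕ.+ b ℕ.* b′ , a ℕ.* b′ ℕ.+ b ℕ.* a′ ⟧
        ≈⟨ ⟦⟧≈ (a ℕ.* a′ ℕ.+ b ℕ.* b′ , a ℕ.* b′ ℕ.+ b ℕ.* a′) ⟩
      ι (a ℕ.* a′ ℕ.+ b ℕ.* b′) - ι (a ℕ.* b′ ℕ.+ b ℕ.* a′)
        ≈⟨ +-cong (ι-bilinear a a′ b b′) (-‿cong (ι-bilinear a b′ b a′)) ⟩
      (ι a * ι a′ + ι b * ι b′) - (ι a * ι b′ + ι b * ι a′)
        ≈⟨ +-congˡ (-‿+-comm _ _) ⟨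
      (ι a * ι a′ + ι b * ι b′) + (- (ι a * ι b′) + - (ι b * ι a′))
        ≈⟨ solve⁺ 4 (λ a b c d → (a :⊕ d) :⊕ (b :⊕ c) :≜ (a :⊕ b) :⊕ (c :⊕ d)) refl _ _ _ _ ⟩
      (ι a * ι a′ + - (ι a * ι b′)) + (- (ι b * ι a′) + ι b * ι b′)
        ≈⟨ +-cong (+-congˡ (-‿distribʳ-* _ _)) (+-cong (-‿distribˡ-* _ _) (sym -‿-‿*)) ⟩
      (ι a * ι a′ + ι a * - ι b′) + (- ι b * ι a′ + - ι b * - ι b′)
        ≈⟨ +-cong (distribˡ _ _ _) (distribˡ _ _ _) ⟨
      ι a * (ι a′ - ι b′) + - ι b * (ι a′ - ι b′)
        ≈⟨ distribʳ _ _ _ ⟨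
      (ι a - ι b) * (ι a′ - ι b′)
        ≈⟨ *-cong (⟦⟧≈ x) (⟦⟧≈ y) ⟨
      ⟦ x ⟧ * ⟦ y ⟧ ∎
      where
      ι-bilinear : ∀ a a′ b b′ → ι (a ℕ.* a′ ℕ.+ b ℕ.* b′) ≈ ι a * ι a′ + ι b * ι b′
      ι-bilinear a a′ b b′ = trans (×-homo-+ 1# (a ℕ.* a′) (b ℕ.* b′))
                                   (+-cong (×1-homo-* a a′) (×1-homo-* b b′))
      -‿-‿* : ∀ {u v} → - u * - v ≈ u * v
      -‿-‿* = trans (sym (-‿distribˡ-* _ _))
             (trans (-‿cong (sym (-‿distribʳ-* _ _))) (-‿involutive _))

    -‿homo : ∀ x → ⟦ RawRing.-_ Difference x ⟧ ≈ - ⟦ x ⟧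
    -‿homo x@(a , b) = begin
      ⟦ b , a ⟧         ≈⟨ ⟦⟧≈ (b , a) ⟩
      ι b - ι a         ≈⟨ ⁻¹-anti-homo‿- _ _ ⟨
      - (ι a - ι b)     ≈⟨ -‿cong (⟦⟧≈ x) ⟨
      - ⟦ x ⟧           ∎

    homomorphism : Difference -Raw-AlmostCommutative⟶ fromCommutativeRing R
    homomorphism = record
      { ⟦_⟧    = ⟦_⟧
      ; +-homo = +-homo
      ; *-homo = *-homo
      ; -‿homo = -‿homo
      ; 0-homo = refl
      ; 1-homo = refl
      }

    -- Two formal differences denote the same integer when their cross sums agree. A failed test
    -- proves nothing, since R may have positive characteristic.
    _≟?_ : ∀ x y → Maybe (⟦ x ⟧ ≈ ⟦ y ⟧)
    x@(a , b) ≟? y@(a′ , b′) with a ℕ.+ b′ ℕ.≟ a′ ℕ.+ b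
    ... | no _  = nothing
    ... | yes e = just (begin
      ⟦ x ⟧                          ≈⟨ ⟦⟧≈ x ⟩
      ι a - ι b                      ≈⟨ +-identityʳ _ ⟨
      (ι a - ι b) + 0#               ≈⟨ +-congˡ (-‿inverseʳ _) ⟨
      (ι a - ι b) + (ι b′ - ι b′)    ≈⟨ solve⁺ 4 (λ a b c d → (a :⊕ b) :⊕ (c :⊕ d) :≜ (a :⊕ c) :⊕ (b :⊕ d))
           refl _ _ _ _ ⟩
      (ι a + ι b′) + (- ι b - ι b′)  ≈⟨ +-congʳ (trans (sym (×-homo-+ 1# a b′)) (trans (×-congˡ e) (×-homo-+ 1# a′ b))) ⟩
      (ι a′ + ι b) + (- ι b - ι b′)  ≈⟨ solve⁺ 4 (λ a b c d → (a :⊕ b) :⊕ (c :⊕ d) :≜ (a :⊕ d) :⊕ (b :⊕ c))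
           refl _ _ _ _ ⟩
      (ι a′ - ι b′) + (ι b - ι b)    ≈⟨ +-congˡ (-‿inverseʳ _) ⟩
      (ι a′ - ι b′) + 0#             ≈⟨ +-identityʳ _ ⟩
      ι a′ - ι b′                    ≈⟨ ⟦⟧≈ y ⟨
      ⟦ y ⟧                          ∎)

    module Solver = RingSolver Difference (fromCommutativeRing R) homomorphism _≟?_

  open Solver public using (solve; _:=_; _:+_; _:*_; _:-_; :-_)

  :0 :1 : ∀ {n} → Solver.Polynomial n
  :0 = Solver.con (0 , 0)
  :1 = Solver.con (1 , 0)

-- Finite sums and square matrices over a commutative ring.

module MatrixAlgebra {c ℓ} (R : CommutativeRing c ℓ) where
  open CommutativeRing R hiding (zero)
  private module Sum = SemiringSum semiring

  -- Opaque because the library's sum unfolds to a fold that blocks the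
  -- inference of the summand.
  opaque
    ∑ : ∀ {n} → (Fin n → Carrier) → Carrier
    ∑ = Sum.sum

    ∑≡sum : ∀ {n} (f : Fin n → Carrier) → ∑ f ≡ Sum.sum f
    ∑≡sum f = ≡.refl

    ∑-cong : ∀ {n} {f g : Fin n → Carrier} → (∀ i → f i ≈ g i) → ∑ f ≈ ∑ g
    ∑-cong {f = f} {g} = Sum.sum-cong-≋ {_} {f} {g}

    ∑-0 : ∀ {n} {f : Fin n → Carrier} → (∀ i → f i ≈ 0#) → ∑ f ≈ 0#
    ∑-0 {n} {f} f≈0 = trans (∑-cong {g = λ _ → 0#} f≈0) (Sum.sum-replicate-zero n)

    ∑-remove : ∀ {n} (f : Fin (suc n) → Carrier) i → ∑ f ≈ f i + ∑ (f ∘ punchIn i)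
    ∑-remove f i = Sum.sum-remove f

    ∑-distrib-+ : ∀ {n} (f g : Fin n → Carrier) → ∑ (λ i → f i + g i) ≈ ∑ f + ∑ g
    ∑-distrib-+ = Sum.∑-distrib-+

    ∑-comm : ∀ {m n} (f : Fin m → Fin n → Carrier) →
             ∑ (λ i → ∑ (f i)) ≈ ∑ (λ j → ∑ λ i → f i j)
    ∑-comm = Sum.∑-comm

    *-distribˡ-∑ : ∀ {n} x (f : Fin n → Carrier) → x * ∑ f ≈ ∑ (λ i → x * f i)
    *-distribˡ-∑ = Sum.*-distribˡ-sum

    *-distribʳ-∑ : ∀ {n} x (f : Fin n → Carrier) → ∑ f * x ≈ ∑ (λ i → f i * x)
    *-distribʳ-∑ = Sum.*-distribʳ-sum

    ∑-inductive : ∀ {p} {P : Carrier → Set p} → P 0# → (∀ {x y} → P x → P y → P (x + y)) →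
                  ∀ {n} {f : Fin n → Carrier} → (∀ i → P (f i)) → P (∑ f)
    ∑-inductive p0 p+ {zero}  pf = p0
    ∑-inductive {P = P} p0 p+ {suc n} {f} pf =
      p+ (pf zero) (∑-inductive {P = P} p0 p+ {f = f ∘ suc} (pf ∘ suc))

    ∑-homo : ∀ {a ℓ′} (R′ : RawRing a ℓ′) (φ : RawRing.Carrier R′ → Carrier) →
             (∀ x y → φ (RawRing._+_ R′ x y) ≈ φ x + φ y) → φ (RawRing.0# R′) ≈ 0# →
             ∀ {n} (f : Fin n → RawRing.Carrier R′) →
             φ (RawSemiringDefinitions.sum (RawRing.rawSemiring R′) f) ≈ ∑ (φ ∘ f)
    ∑-homo R′ φ +-homo 0-homo {zero}  f = 0-homo
    ∑-homo R′ φ +-homo 0-homo {suc n} f = trans (+-homo _ _) (+-congˡ (∑-homo R′ φ +-homo 0-homo (f ∘ suc)))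

  ∑-only : ∀ {n} (f : Fin n → Carrier) i → (∀ j → j ≢ i → f j ≈ 0#) → ∑ f ≈ f i
  ∑-only {suc n} f i f≈0 = begin
    ∑ f                        ≈⟨ ∑-remove f i ⟩
    f i + ∑ (f ∘ punchIn i)    ≈⟨ +-congˡ (∑-0 λ j → f≈0 _ (punchInᵢ≢i i j)) ⟩
    f i + 0#                   ≈⟨ +-identityʳ _ ⟩
    f i                        ∎
    where open SetoidReasoning setoid

  δ : ∀ {n} → SquareMatrix Carrier n
  δ i j = if does (i ≟ j) then 1# else 0#

  δ-refl : ∀ {n} (i : Fin n) → δ i i ≈ 1#
  δ-refl i with i ≟ i
  ... | yes _  = refl
  ... | no i≢i = contradiction ≡.refl i≢i

  δ-≢ : ∀ {n} {i j : Fin n} → i ≢ j → δ i j ≈ 0#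
  δ-≢ {i = i} {j} i≢j with i ≟ j
  ... | yes i≡j = contradiction i≡j i≢j
  ... | no _    = refl

  δ-sym : ∀ {n} (i j : Fin n) → δ i j ≈ δ j i
  δ-sym i j with i ≟ j
  ... | yes ≡.refl = sym (δ-refl i)
  ... | no i≢j     = sym (δ-≢ (i≢j ∘ ≡.sym))

  ∑-δˡ : ∀ {n} i (f : Fin n → Carrier) → ∑ (λ j → δ i j * f j) ≈ f i
  ∑-δˡ i f = trans (∑-only _ i λ j j≢i → trans (*-congʳ (δ-≢ (j≢i ∘ ≡.sym))) (zeroˡ _))
                     (trans (*-congʳ (δ-refl i)) (*-identityˡ _))

  ∑-δʳ : ∀ {n} i (f : Fin n → Carrier) → ∑ (λ j → f j * δ j i) ≈ f i
  ∑-δʳ i f = trans (∑-cong λ j → trans (*-comm _ _) (*-congʳ (δ-sym j i))) (∑-δˡ i f)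

  infix 4 _≋_
  _≋_ : ∀ {n} → SquareMatrix Carrier n → SquareMatrix Carrier n → Set ℓ
  A ≋ B = ∀ i j → A i j ≈ B i j

  matrixSetoid : ℕ → Setoid c ℓ
  matrixSetoid n = record
    { Carrier = SquareMatrix Carrier n
    ; _≈_ = _≋_
    ; isEquivalence = record
      { refl  = λ _ _ → refl
      ; sym   = λ p i j → sym (p i j)
      ; trans = λ p q i j → trans (p i j) (q i j)
      }
    }

  module ≋-Reasoning {n} = SetoidReasoning (matrixSetoid n)

  infixl 7 _∙_
  _∙_ : ∀ {n} → SquareMatrix Carrier n → SquareMatrix Carrier n → SquareMatrix Carrier n
  (A ∙ B) i j = ∑ λ k → A i k * B k j

  infix 9 _ᵀ
  _ᵀ : ∀ {n} → SquareMatrix Carrier n → SquareMatrix Carrier n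
  (A ᵀ) i j = A j i

  module _ {n : ℕ} where
    private
      Mat = SquareMatrix Carrier n
      variable A B C D : Mat

    ∙-cong : A ≋ B → C ≋ D → A ∙ C ≋ B ∙ D
    ∙-cong p q i j = ∑-cong λ k → *-cong (p i k) (q k j)

    ∙-congˡ : (A : Mat) → B ≋ C → A ∙ B ≋ A ∙ C
    ∙-congˡ A q = ∙-cong {A = A} (λ _ _ → refl) q

    ∙-congʳ : (C : Mat) → A ≋ B → A ∙ C ≋ B ∙ C
    ∙-congʳ C p = ∙-cong {C = C} p (λ _ _ → refl)

    ∙-assoc : (A B C : Mat) → (A ∙ B) ∙ C ≋ A ∙ (B ∙ C)
    ∙-assoc A B C i j = begin
      ∑ (λ k → ∑ (λ l → A i l * B l k) * C k j)
        ≈⟨ ∑-cong (λ k → *-distribʳ-∑ (C k j) (λ l → A i l * B l k)) ⟩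
      ∑ (λ k → ∑ (λ l → A i l * B l k * C k j))
        ≈⟨ ∑-comm (λ k l → A i l * B l k * C k j) ⟩
      ∑ (λ l → ∑ (λ k → A i l * B l k * C k j))
        ≈⟨ ∑-cong (λ l → ∑-cong (λ k → *-assoc _ _ _)) ⟩
      ∑ (λ l → ∑ (λ k → A i l * (B l k * C k j)))
        ≈⟨ ∑-cong (λ l → *-distribˡ-∑ (A i l) (λ k → B l k * C k j)) ⟨
      ∑ (λ l → A i l * ∑ (λ k → B l k * C k j)) ∎
      where open SetoidReasoning setoid

    ∙-identityˡ : (A : Mat) → δ ∙ A ≋ A
    ∙-identityˡ A i j = ∑-δˡ i (λ k → A k j)

    ∙-identityʳ : (A : Mat) → A ∙ δ ≋ A
    ∙-identityʳ A i j = ∑-δʳ j (A i)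

    ∙-ᵀ : (A B : Mat) → (A ∙ B) ᵀ ≋ B ᵀ ∙ A ᵀ
    ∙-ᵀ A B i j = ∑-cong λ k → *-comm _ _

    -- Transposing A B = 1 makes Bᵀ a left inverse of A, and a left inverse agrees with a right
    -- inverse.
    symmetric-inverse : A ᵀ ≋ A → A ∙ B ≋ δ → B ᵀ ≋ B
    symmetric-inverse {A} {B} Aᵀ≋A AB≋δ = begin
      B ᵀ              ≈⟨ ∙-identityʳ (B ᵀ) ⟨
      B ᵀ ∙ δ          ≈⟨ ∙-congˡ (B ᵀ) AB≋δ ⟨
      B ᵀ ∙ (A ∙ B)    ≈⟨ ∙-assoc (B ᵀ) A B ⟨
      B ᵀ ∙ A ∙ B      ≈⟨ ∙-congʳ B BᵀA≋δ ⟩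
      δ ∙ B            ≈⟨ ∙-identityˡ B ⟩
      B                ∎
      where
      BᵀA≋δ : B ᵀ ∙ A ≋ δ
      BᵀA≋δ i j = trans (∑-cong λ k → trans (*-congˡ (sym (Aᵀ≋A k j))) (*-comm _ _))
                        (trans (AB≋δ j i) (δ-sym j i))
      open SetoidReasoning (matrixSetoid n)

-- Determinants: expansions, adjugate and Cramer's rule.

punchIn-pinch : ∀ {n} (i : Fin (suc (suc n))) j → punchIn (punchIn i j) (pinch j i) ≡ i
punchIn-pinch zero    j       = ≡.refl
punchIn-pinch (suc i) zero    = ≡.refl
punchIn-pinch {suc n} (suc i) (suc j) = ≡.cong suc (punchIn-pinch i j)

-- Two indices may be deleted in either order: once `punchIn i j` is gone, i sits at position
-- `pinch j i`.
punchIn-comm : ∀ {n} (i : Fin (suc (suc n))) j k →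
               punchIn (punchIn i j) (punchIn (pinch j i) k) ≡ punchIn i (punchIn j k)
punchIn-comm zero    j       k       = ≡.refl
punchIn-comm (suc i) zero    k       = ≡.refl
punchIn-comm {suc n} (suc i) (suc j) zero    = ≡.refl
punchIn-comm {suc n} (suc i) (suc j) (suc k) = ≡.cong suc (punchIn-comm i j k)

thirdIndex : ∀ {n} {p q : Fin (suc (suc (suc n)))} → p ≢ q → ∃[ i ] i ≢ p × i ≢ q
thirdIndex {p = p} {q} p≢q = i , punchInᵢ≢i p _ , i≢q
  where
  q′ = punchOut p≢q
  i  = punchIn p (punchIn q′ zero)
  i≢q : i ≢ q
  i≢q i≡q = punchInᵢ≢i q′ zero
    (punchIn-injective p _ _ (≡.trans i≡q (≡.sym (punchIn-punchOut p≢q))))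

minor : ∀ {c} {A : Set c} {n} → SquareMatrix A (suc n) → Fin (suc n) → Fin (suc n) → SquareMatrix A n
minor M i j r s = M (punchIn i r) (punchIn j s)

module DeterminantTheory {r ℓ} (R : CommutativeRing r ℓ) where
  open CommutativeRing R hiding (zero)
  open MatrixAlgebra R
  open Determinant rawRing using (det) public
  open RawSemiringDefinitions (RawRing.rawSemiring rawRing) using (_^_)
  open IntegerCoefficientSolver R
  open SetoidReasoning setoid

  private Mat = SquareMatrix Carrier

  sgn : ℕ → Carrier
  sgn = (- 1#) ^_

  sgn-+ : ∀ m n → sgn (m ℕ.+ n) ≈ sgn m * sgn n
  sgn-+ = SemiringExp.^-homo-* semiring (- 1#)

  sgn-double : ∀ n → sgn (n ℕ.+ n) ≈ 1#
  sgn-double zero    = refl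
  sgn-double (suc n) = begin
    - 1# * sgn (n ℕ.+ suc n)       ≡⟨ ≡.cong (λ m → - 1# * sgn m) (ℕ.+-suc n n) ⟩
    - 1# * (- 1# * sgn (n ℕ.+ n))  ≈⟨ solve 1 (λ x → :- :1 :* (:- :1 :* x) := x) refl _ ⟩
    sgn (n ℕ.+ n)                  ≈⟨ sgn-double n ⟩
    1#                             ∎

  -- Exchanging the order of two deletions changes the sum of the two positions by exactly one, up
  -- or down according to which index is larger.
  sgn-pinch : ∀ {n} (i : Fin (suc (suc n))) j →
    sgn (toℕ (punchIn i j)) * sgn (toℕ (pinch j i)) ≈ - (sgn (toℕ i) * sgn (toℕ j))
  sgn-pinch zero j = solve 1 (λ x → :- :1 :* x :* :1 := :- (:1 :* x)) refl _
  sgn-pinch (suc i) zero = solve 1 (λ x → :1 :* x := :- (:- :1 :* x :* :1)) refl _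
  sgn-pinch {suc n} (suc i) (suc j) = begin
    (- 1# * a) * (- 1# * b)    ≈⟨ solve 2 (λ x y → (:- :1 :* x) :* (:- :1 :* y) := x :* y)
         refl a b ⟩
    a * b                      ≈⟨ sgn-pinch i j ⟩
    - (c * d)                  ≈⟨ solve 2 (λ x y → :- (x :* y) := :- ((:- :1 :* x) :* (:- :1 :* y)))
         refl c d ⟩
    - ((- 1# * c) * (- 1# * d)) ∎
    where
    a = sgn (toℕ (punchIn i j))
    b = sgn (toℕ (pinch j i))
    c = sgn (toℕ i)
    d = sgn (toℕ j)

  rowExpansion : ∀ {n} (M : Mat (suc n)) →
    det M ≈ ∑ λ j → sgn (toℕ j) * (M zero j * det (minor M zero j))
  rowExpansion M = reflexive (≡.sym (∑≡sum λ j → sgn (toℕ j) * (M zero j * det (minor M zero j))))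

  det-cong : ∀ {n} {A B : Mat n} → A ≋ B → det A ≈ det B
  det-cong {zero}          A≋B = refl
  det-cong {suc n} {A} {B} A≋B = begin
    det A  ≈⟨ rowExpansion A ⟩
    _      ≈⟨ ∑-cong (λ j → *-congˡ (*-cong (A≋B zero j) (det-cong {n} λ r s → A≋B (suc r) (punchIn j s)))) ⟩
    _      ≈⟨ rowExpansion B ⟨
    det B  ∎

  cofactor : ∀ {n} → Mat (suc n) → Fin (suc n) → Fin (suc n) → Carrier
  cofactor M k i = sgn (toℕ i ℕ.+ toℕ k) * det (minor M k i)

  -- Every first-row minor except that of column i still contains column i and is expanded along it
  -- by induction. After the two sums are exchanged, the inner ones are first-row expansions of the
  -- minors of column i.
  columnExpansion : ∀ {n} (M : Mat (suc n)) i → det M ≈ ∑ λ k → cofactor M k i * M k i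
  columnExpansion {zero}  M zero = begin
    det M  ≈⟨ rowExpansion M ⟩
    _      ≈⟨ ∑-cong {1} (λ { zero → solve 2 (λ m d → :1 :* (m :* d) := :1 :* d :* m) refl _ _ }) ⟩
    _      ∎
  columnExpansion {suc n} M i = begin
    det M
      ≈⟨ rowExpansion M ⟩
    ∑ row
      ≈⟨ ∑-remove row i ⟩
    row i + ∑ (λ j → row (punchIn i j))
      ≈⟨ +-cong first (∑-cong expandMinor) ⟩
    col zero + ∑ (λ j → ∑ λ k → term j k)
      ≈⟨ +-congˡ (∑-comm term) ⟩
    col zero + ∑ (λ k → ∑ λ j → term j k)
      ≈⟨ +-congˡ (∑-cong collect) ⟩
    col zero + ∑ (λ k → col (suc k))
      ≈⟨ ∑-remove col zero ⟨
    ∑ col ∎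
    where
    row col : Fin (suc (suc n)) → Carrier
    row j = sgn (toℕ j) * (M zero j * det (minor M zero j))
    col k = cofactor M k i * M k i

    D : Fin (suc n) → Fin (suc n) → Carrier
    D j k = det (minor (minor M (suc k) i) zero j)

    term : Fin (suc n) → Fin (suc n) → Carrier
    term j k = (sgn (toℕ i ℕ.+ suc (toℕ k)) * (sgn (toℕ j) * (M zero (punchIn i j) * D j k))) * M (suc k) i

    first : row i ≈ col zero
    first = begin
      sgn (toℕ i) * (M zero i * det (minor M zero i))
        ≡⟨ ≡.cong (λ m → sgn m * (M zero i * det (minor M zero i))) (ℕ.+-identityʳ (toℕ i)) ⟨
      sgn (toℕ i ℕ.+ 0) * (M zero i * det (minor M zero i))
        ≈⟨ solve 3 (λ s m d → s :* (m :* d) := s :* d :* m) refl _ _ _ ⟩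
      col zero ∎

    expandMinor : ∀ j → row (punchIn i j) ≈ ∑ (term j)
    expandMinor j = begin
      s * (m * det N)                       ≈⟨ *-congˡ (*-congˡ (columnExpansion N i′)) ⟩
      s * (m * ∑ f)                         ≈⟨ *-assoc _ _ _ ⟨
      s * m * ∑ f                           ≈⟨ *-distribˡ-∑ (s * m) f ⟩
      ∑ (λ k → s * m * f k)                 ≈⟨ ∑-cong same ⟩
      ∑ (term j)                            ∎
      where
      i′ = pinch j i
      N = minor M zero (punchIn i j)
      s = sgn (toℕ (punchIn i j))
      m = M zero (punchIn i j)
      f : Fin (suc n) → Carrier
      f k = cofactor N k i′ * N k i′
      same : ∀ k → s * m * f k ≈ term j k
      same k = begin
        s * m * (sgn (toℕ i′ ℕ.+ toℕ k) * det (minor N k i′) * N k i′)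
          ≈⟨ *-congˡ (*-cong (*-cong (sgn-+ (toℕ i′) (toℕ k)) minors) entries) ⟩
        s * m * (sgn (toℕ i′) * sgn (toℕ k) * D j k * M (suc k) i)
          ≈⟨ solve 6 (λ s m i′ k d e → s :* m :* (i′ :* k :* d :* e) := s :* i′ :* (k :* (m :* d)) :* e)
               refl _ _ _ _ _ _ ⟩
        s * sgn (toℕ i′) * (sgn (toℕ k) * (m * D j k)) * M (suc k) i
          ≈⟨ *-congʳ (*-congʳ (sgn-pinch i j)) ⟩
        - (sgn (toℕ i) * sgn (toℕ j)) * (sgn (toℕ k) * (m * D j k)) * M (suc k) i
          ≈⟨ solve 6 (λ i j k m d e → :- (i :* j) :* (k :* (m :* d)) :* e := i :* (:- :1 :* k) :* (j :* (m :* d)) :* e)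
               refl _ _ _ _ _ _ ⟩
        sgn (toℕ i) * sgn (suc (toℕ k)) * (sgn (toℕ j) * (m * D j k)) * M (suc k) i
          ≈⟨ *-congʳ (*-congʳ (sgn-+ (toℕ i) (suc (toℕ k)))) ⟨
        term j k ∎
        where
        entries : N k i′ ≈ M (suc k) i
        entries = reflexive (≡.cong (M (suc k)) (punchIn-pinch i j))
        minors : det (minor N k i′) ≈ D j k
        minors = det-cong {n} λ r c → reflexive (≡.cong (M (suc (punchIn k r))) (punchIn-comm i j c))

    collect : ∀ k → ∑ (λ j → term j k) ≈ col (suc k)
    collect k = begin
      ∑ (λ j → term j k)        ≈⟨ *-distribʳ-∑ (M (suc k) i) (λ j → s * g j) ⟨
      ∑ (λ j → s * g j) * M (suc k) i ≈⟨ *-congʳ (*-distribˡ-∑ s g) ⟨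
      s * ∑ g * M (suc k) i     ≈⟨ *-congʳ (*-congˡ (rowExpansion (minor M (suc k) i))) ⟨
      col (suc k)               ∎
      where
      s = sgn (toℕ i ℕ.+ suc (toℕ k))
      g : Fin (suc n) → Carrier
      g j = sgn (toℕ j) * (M zero (punchIn i j) * D j k)

  -- From size three on, expansion along a column other than p and q leaves two equal columns in
  -- every minor; size two is a direct computation.
  det-equalColumns : ∀ {n} (M : Mat n) {p q} → p ≢ q → (∀ r → M r p ≈ M r q) → det M ≈ 0#
  det-equalColumns {suc zero} M {zero} {zero} p≢q eq = contradiction ≡.refl p≢q
  det-equalColumns {suc (suc zero)} M {p} {q} p≢q eq = begin
    det M
      ≈⟨ solve 4 (λ a b c d → :1 :* (a :* (:1 :* (d :* :1) :+ :0)) :+ ((:- :1 :* :1) :* (b :* (:1 :* (c :* :1) :+ :0)) :+ :0) := a :* d :- b :* c)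
           refl _ _ _ _ ⟩
    M zero zero * M one one - M zero one * M one zero
      ≈⟨ +-cong (*-congʳ (cols zero)) (-‿cong (*-congˡ (cols one))) ⟩
    M zero one * M one one - M zero one * M one one
      ≈⟨ -‿inverseʳ _ ⟩
    0# ∎
    where
    one = suc zero
    cols : ∀ r → M r zero ≈ M r one
    cols = go p q p≢q eq
      where
      go : ∀ p q → p ≢ q → (∀ r → M r p ≈ M r q) → ∀ r → M r zero ≈ M r one
      go zero       zero       p≢q eq = contradiction ≡.refl p≢q
      go zero       (suc zero) p≢q eq = eq
      go (suc zero) zero       p≢q eq = sym ∘ eq
      go (suc zero) (suc zero) p≢q eq = contradiction ≡.refl p≢q
  det-equalColumns {suc (suc (suc n))} M {p} {q} p≢q eq = begin
    det M    ≈⟨ columnExpansion M i ⟩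
    _        ≈⟨ ∑-0 (λ k → trans (*-congʳ (trans (*-congˡ (det-equalColumns (minor M k i) p′≢q′ (minor-eq k))) (zeroʳ _))) (zeroˡ _)) ⟩
    0#       ∎
    where
    third = thirdIndex p≢q
    i = proj₁ third
    i≢p = proj₁ (proj₂ third)
    i≢q = proj₂ (proj₂ third)
    p′ = punchOut i≢p
    q′ = punchOut i≢q
    p′≢q′ : p′ ≢ q′
    p′≢q′ e = p≢q (≡.trans (≡.sym (punchIn-punchOut i≢p))
                  (≡.trans (≡.cong (punchIn i) e) (punchIn-punchOut i≢q)))
    minor-eq : ∀ k r → minor M k i r p′ ≈ minor M k i r q′
    minor-eq k r = trans (reflexive (≡.cong (M (punchIn k r)) (punchIn-punchOut i≢p)))
                   (trans (eq (punchIn k r))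
                          (reflexive (≡.cong (M (punchIn k r)) (≡.sym (punchIn-punchOut i≢q)))))

  -- Cofactors of column i do not see that column. For i ≠ j the sum is thus the expansion of `M′`,
  -- in which column i is overwritten by column j and two columns coincide.
  adjugate-inverse : ∀ {n} (M : Mat (suc n)) i j → ∑ (λ k → cofactor M k i * M k j) ≈ det M * δ i j
  adjugate-inverse M i j with i ≟ j
  ... | yes ≡.refl = trans (sym (columnExpansion M i)) (sym (*-identityʳ _))
  ... | no i≢j     = begin
    ∑ (λ k → cofactor M k i * M k j)
      ≈⟨ ∑-cong (λ k → *-cong (*-congˡ {sgn (toℕ i ℕ.+ toℕ k)} (det-cong λ r s → reflexive (≡.sym (updateAt-minimal (punchIn i s) i (M (punchIn k r)) (punchInᵢ≢i i s)))))
                              (reflexive (≡.sym (updateAt-updates i (M k))))) ⟩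
    ∑ (λ k → cofactor M′ k i * M′ k i)
      ≈⟨ columnExpansion M′ i ⟨
    det M′
      ≈⟨ det-equalColumns M′ i≢j (λ r → reflexive (≡.trans (updateAt-updates i (M r)) (≡.sym (updateAt-minimal j i (M r) (i≢j ∘ ≡.sym))))) ⟩
    0#
      ≈⟨ zeroʳ _ ⟨
    det M * 0# ∎
    where
    M′ : Mat _
    M′ r = updateAt (M r) i (const (M r j))

  -- Evaluate adj · M · Y in both orders. Nothing is divided by det M, so this serves both over the
  -- dual numbers and under the assumption det M = 0.
  cofactor-inverse : ∀ {n} (M Y : Mat (suc n)) → M ∙ Y ≋ δ → ∀ k i → cofactor M k i ≈ det M * Y i k
  cofactor-inverse {n} M Y MY≋δ k i = begin
    adj i k               ≈⟨ ∙-identityʳ adj i k ⟨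
    (adj ∙ δ) i k         ≈⟨ ∙-congˡ adj MY≋δ i k ⟨
    (adj ∙ (M ∙ Y)) i k   ≈⟨ ∙-assoc adj M Y i k ⟨
    (adj ∙ M ∙ Y) i k     ≈⟨ ∙-congʳ Y (adjugate-inverse M) i k ⟩
    ∑ (λ j → det M * δ i j * Y j k)    ≈⟨ ∑-cong (λ j → *-assoc _ _ _) ⟩
    ∑ (λ j → det M * (δ i j * Y j k))  ≈⟨ *-distribˡ-∑ (det M) (λ j → δ i j * Y j k) ⟨
    det M * ∑ (λ j → δ i j * Y j k)    ≈⟨ *-congˡ (∑-δˡ i (λ j → Y j k)) ⟩
    det M * Y i k         ∎
    where
    adj : Mat (suc n)
    adj i k = cofactor M k i

  -- Cramer's rule on the diagonal, where the sign is even. This links deleted vertices with the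
  -- diagonal of the inverse.
  principalMinor-inverse : ∀ {n} (M Y : Mat (suc n)) → M ∙ Y ≋ δ → ∀ i → det (M ⟨ i ⟩) ≈ det M * Y i i
  principalMinor-inverse M Y MY≋δ i = begin
    det (M ⟨ i ⟩)      ≈⟨ *-identityˡ _ ⟨
    1# * det (M ⟨ i ⟩) ≈⟨ *-congʳ (sgn-double (toℕ i)) ⟨
    cofactor M i i     ≈⟨ cofactor-inverse M Y MY≋δ i i ⟩
    det M * Y i i      ∎

-- Determinants under ring homomorphisms; dual numbers.

record PreservesRingOperations {a ℓ₁ b ℓ₂} (R : RawRing a ℓ₁) (S : CommutativeRing b ℓ₂)
    (φ : RawRing.Carrier R → CommutativeRing.Carrier S) : Set (a ⊔ ℓ₂) where
  private module R = RawRing R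
  open CommutativeRing S
  field
    +-homo : ∀ x y → φ (x R.+ y) ≈ φ x + φ y
    *-homo : ∀ x y → φ (x R.* y) ≈ φ x * φ y
    -‿homo : ∀ x → φ (R.- x) ≈ - φ x
    0-homo : φ R.0# ≈ 0#
    1-homo : φ R.1# ≈ 1#

module DeterminantHomomorphism {a ℓ₁ b ℓ₂} {R : RawRing a ℓ₁} {S : CommutativeRing b ℓ₂}
  {φ : RawRing.Carrier R → CommutativeRing.Carrier S} (φ-homo : PreservesRingOperations R S φ) where
  open CommutativeRing S hiding (zero)
  open PreservesRingOperations φ-homo
  private module R = RawRing R
  open MatrixAlgebra S
  open DeterminantTheory S
  open RawSemiringDefinitions R.rawSemiring using (_^_)
  open SetoidReasoning setoid
  private
    module DetR = Determinant R

    sgn-homo : ∀ k → φ ((R.- R.1#) ^ k) ≈ sgn k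
    sgn-homo zero  = 1-homo
    sgn-homo (suc k) = trans (*-homo _ _) (*-cong (trans (-‿homo _) (-‿cong 1-homo)) (sgn-homo k))

  -- The source is only a raw ring, so that the lemma applies to coefficient lists, whose ring laws
  -- are never established.
  det-homo : ∀ {n} (M : SquareMatrix R.Carrier n) → φ (DetR.det M) ≈ det (λ i j → φ (M i j))
  det-homo {zero}  M = 1-homo
  det-homo {suc n} M = begin
    φ (DetR.det M)
      ≈⟨ ∑-homo R φ +-homo 0-homo {suc n} (λ j → ((R.- R.1#) ^ toℕ j) R.* (M zero j R.* DetR.det (minor M zero j))) ⟩
    ∑ (λ j → φ (((R.- R.1#) ^ toℕ j) R.* (M zero j R.* DetR.det (minor M zero j))))
      ≈⟨ ∑-cong (λ j → trans (*-homo _ _) (*-cong (sgn-homo (toℕ j))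
           (trans (*-homo _ _) (*-congˡ (det-homo (minor M zero j)))))) ⟩
    _ ≈⟨ rowExpansion (λ i j → φ (M i j)) ⟨
    det (λ i j → φ (M i j)) ∎

-- (x , y) stands for x + y ε with ε² = 0.
module DualNumbers {c ℓ} (R : CommutativeRing c ℓ) where
  open CommutativeRing R
  open IntegerCoefficientSolver R

  dualNumbers : CommutativeRing c ℓ
  dualNumbers = record
    { Carrier = Carrier × Carrier
    ; _≈_ = λ (x , x′) (y , y′) → x ≈ y × x′ ≈ y′
    ; _+_ = λ (x , x′) (y , y′) → x + y , x′ + y′
    ; _*_ = λ (x , x′) (y , y′) → x * y , x * y′ + x′ * y
    ; -_  = λ (x , x′) → - x , - x′
    ; 0#  = 0# , 0#
    ; 1#  = 1# , 0#
    ; isCommutativeRing = record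
      { isRing = record
        { +-isAbelianGroup = AbelianGroup.isAbelianGroup
                               (DirectProduct.abelianGroup +-abelianGroup +-abelianGroup)
        ; *-cong     = λ (p , p′) (q , q′) → *-cong p q , +-cong (*-cong p q′) (*-cong p′ q)
        ; *-assoc    = λ (x , x′) (y , y′) (z , z′) → *-assoc x y z ,
            solve 6 (λ x x′ y y′ z z′ → x :* y :* z′ :+ (x :* y′ :+ x′ :* y) :* z
                                     := x :* (y :* z′ :+ y′ :* z) :+ x′ :* (y :* z))
                                          refl x x′ y y′ z z′
        ; *-identity =
            (λ (x , x′) → *-identityˡ x , solve 2 (λ x x′ → :1 :* x′ :+ :0 :* x := x′) refl x x′) ,
            (λ (x , x′) → *-identityʳ x , solve 2 (λ x x′ → x :* :0 :+ x′ :* :1 := x′) refl x x′)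
        ; distrib    =
            (λ (x , x′) (y , y′) (z , z′) → distribˡ x y z ,
              solve 6 (λ x x′ y y′ z z′ → x :* (y′ :+ z′) :+ x′ :* (y :+ z)
                                       := (x :* y′ :+ x′ :* y) :+ (x :* z′ :+ x′ :* z))
                                            refl x x′ y y′ z z′) ,
            (λ (x , x′) (y , y′) (z , z′) → distribʳ x y z ,
              solve 6 (λ x x′ y y′ z z′ → (y :+ z) :* x′ :+ (y′ :+ z′) :* x
                                       := (y :* x′ :+ y′ :* x) :+ (z :* x′ :+ z′ :* x))
                                            refl x x′ y y′ z z′)
        }
      ; *-comm = λ (x , x′) (y , y′) → *-comm x y ,
          solve 4 (λ x x′ y y′ → x :* y′ :+ x′ :* y := y :* x′ :+ y′ :* x) refl x x′ y y′
      }
    }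

-- Low coefficients of polynomials and the multiplicity of the root 0.

module PolynomialCoefficients {c ℓ} (R : CommutativeRing c ℓ) where
  open CommutativeRing R hiding (zero)
  open IntegerCoefficientSolver R
  open Polynomial rawRing
  open RawRing polyRawRing using () renaming (-_ to -ₚ_)
  open RawMagmaDefinitions using (_,_)
  open SetoidReasoning setoid

  coeff-+ : ∀ p q k → coeff (p +ₚ q) k ≈ coeff p k + coeff q k
  coeff-+ []      q       k       = sym (+-identityˡ _)
  coeff-+ (a ∷ p) []      k       = sym (+-identityʳ _)
  coeff-+ (a ∷ p) (b ∷ q) zero    = refl
  coeff-+ (a ∷ p) (b ∷ q) (suc k) = coeff-+ p q k

  coeff-neg : ∀ p k → coeff (-ₚ p) k ≈ - coeff p k
  coeff-neg []      k       = sym (RingProperties.-0#≈0# ring)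
  coeff-neg (a ∷ p) zero    = refl
  coeff-neg (a ∷ p) (suc k) = coeff-neg p k

  coeff-scale : ∀ a p k → coeff (map (a *_) p) k ≈ a * coeff p k
  coeff-scale a []      k       = sym (zeroʳ a)
  coeff-scale a (b ∷ p) zero    = refl
  coeff-scale a (b ∷ p) (suc k) = coeff-scale a p k

  coeff-∷-* : ∀ a p q k → coeff ((a ∷ p) *ₚ q) k ≈ a * coeff q k + coeff (0# ∷ (p *ₚ q)) k
  coeff-∷-* a p q k = trans (coeff-+ (map (a *_) q) (0# ∷ (p *ₚ q)) k) (+-congʳ (coeff-scale a q k))

  coeff-*-0 : ∀ p q → coeff (p *ₚ q) 0 ≈ coeff p 0 * coeff q 0
  coeff-*-0 []      q = sym (zeroˡ _)
  coeff-*-0 (a ∷ p) q = trans (coeff-∷-* a p q 0) (+-identityʳ _)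

  coeff-*-1 : ∀ p q → coeff (p *ₚ q) 1 ≈ coeff p 0 * coeff q 1 + coeff p 1 * coeff q 0
  coeff-*-1 []      q = sym (solve 2 (λ x y → :0 :* x :+ :0 :* y := :0) refl _ _)
  coeff-*-1 (a ∷ p) q = trans (coeff-∷-* a p q 1) (+-congˡ (coeff-*-0 p q))

  coeff-*-constant : ∀ p b k → coeff (p *ₚ constant b) k ≈ coeff p k * b
  coeff-*-constant []      b k       = sym (zeroˡ _)
  coeff-*-constant (a ∷ p) b zero    = trans (coeff-∷-* a p (constant b) 0) (+-identityʳ _)
  coeff-*-constant (a ∷ p) b (suc k) = begin
    coeff ((a ∷ p) *ₚ constant b) (suc k)      ≈⟨ coeff-∷-* a p (constant b) (suc k) ⟩
    a * 0# + coeff (p *ₚ constant b) k         ≈⟨ +-cong (zeroʳ a) (coeff-*-constant p b k) ⟩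
    0# + coeff p k * b                         ≈⟨ +-identityˡ _ ⟩
    coeff p k * b                              ∎

  coeff-*-linear : ∀ p c d k → coeff (p *ₚ (c ∷ d ∷ [])) (suc k) ≈ coeff p (suc k) * c + coeff p k * d
  coeff-*-linear []      c d k       = sym (solve 2 (λ x y → :0 :* x :+ :0 :* y := :0) refl _ _)
  coeff-*-linear (a ∷ p) c d zero    = begin
    coeff ((a ∷ p) *ₚ (c ∷ d ∷ [])) 1          ≈⟨ coeff-∷-* a p (c ∷ d ∷ []) 1 ⟩
    a * d + coeff (p *ₚ (c ∷ d ∷ [])) 0        ≈⟨ +-congˡ (coeff-*-0 p (c ∷ d ∷ [])) ⟩
    a * d + coeff p 0 * c                      ≈⟨ +-comm _ _ ⟩
    coeff p 0 * c + a * d                      ∎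
  coeff-*-linear (a ∷ p) c d (suc k) = begin
    coeff ((a ∷ p) *ₚ (c ∷ d ∷ [])) (suc (suc k))    ≈⟨ coeff-∷-* a p (c ∷ d ∷ []) (suc (suc k)) ⟩
    a * 0# + coeff (p *ₚ (c ∷ d ∷ [])) (suc k)       ≈⟨ +-cong (zeroʳ a) (coeff-*-linear p c d k) ⟩
    0# + (coeff p (suc k) * c + coeff p k * d)       ≈⟨ +-identityˡ _ ⟩
    coeff p (suc k) * c + coeff p k * d              ∎

  -- Multiples of L, which is X - 0, have constant coefficient zero.
  simpleNonRoot : ∀ p → coeff p 0 ≉ 0# → IsRootMultiplicity p 0# 0
  simpleNonRoot p p₀≉0 = (p , λ k → trans (coeff-*-constant p 1# k) (*-identityʳ _)) ,
    λ { (q , qL≈p) → p₀≉0 (begin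
      coeff p 0                            ≈⟨ qL≈p 0 ⟨
      coeff (q *ₚ (L *ₚ constant 1#)) 0    ≈⟨ coeff-*-0 q (L *ₚ constant 1#) ⟩
      coeff q 0 * ((0# - 0#) * 1# + 0#)    ≈⟨ solve 1 (λ x → x :* ((:0 :- :0) :* :1 :+ :0) := :0)
           refl _ ⟩
      0#                                   ∎) }
    where
    L = X +ₚ (-ₚ constant 0#)

  -- Dividing by X drops the head of the list, and a multiple of L² has no term of degree one.
  -- Expressions such as `(0# - 0#) * 1# + 0#` are the unreduced coefficients of `L *ₚ constant 1#`.
  simpleRoot : ∀ p → coeff p 0 ≈ 0# → coeff p 1 ≉ 0# → IsRootMultiplicity p 0# 1
  simpleRoot p p₀≈0 p₁≉0 = (shift p , λ { k → divides p p₀≈0 k }) ,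
    λ { (q , qLL≈p) → p₁≉0 (begin
      coeff p 1                                   ≈⟨ qLL≈p 1 ⟨
      coeff (q *ₚ LL) 1                           ≈⟨ coeff-*-1 q LL ⟩
      coeff q 0 * coeff LL 1 + coeff q 1 * coeff LL 0
        ≈⟨ +-cong (*-congˡ (coeff-*-1 L (L *ₚ constant 1#))) (*-congˡ (coeff-*-0 L (L *ₚ constant 1#))) ⟩
      coeff q 0 * ((0# - 0#) * (1# * 1# + 0#) + 1# * ((0# - 0#) * 1# + 0#)) + coeff q 1 * ((0# - 0#) * ((0# - 0#) * 1# + 0#))
        ≈⟨ solve 2 (λ x y → x :* ((:0 :- :0) :* (:1 :* :1 :+ :0) :+ :1 :* ((:0 :- :0) :* :1 :+ :0)) :+ y :* ((:0 :- :0) :* ((:0 :- :0) :* :1 :+ :0)) := :0)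
             refl _ _ ⟩
      0#                                          ∎) }
    where
    L  = X +ₚ (-ₚ constant 0#)
    LL = L *ₚ (L *ₚ constant 1#)
    shift : Poly → Poly
    shift []      = []
    shift (_ ∷ p) = p
    divides : ∀ p → coeff p 0 ≈ 0# → (shift p *ₚ (L *ₚ constant 1#)) ≈ₚ p
    divides []      p₀≈0 k    = refl
    divides (a ∷ p) a≈0 zero = begin
      coeff (p *ₚ (L *ₚ constant 1#)) 0    ≈⟨ coeff-*-0 p (L *ₚ constant 1#) ⟩
      coeff p 0 * ((0# - 0#) * 1# + 0#)    ≈⟨ solve 1 (λ x → x :* ((:0 :- :0) :* :1 :+ :0) := :0)
           refl _ ⟩
      0#                                   ≈⟨ a≈0 ⟨
      a                                    ∎
    divides (a ∷ p) a≈0 (suc k) = begin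
      coeff (p *ₚ (L *ₚ constant 1#)) (suc k)
        ≈⟨ coeff-*-linear p _ _ k ⟩
      coeff p (suc k) * ((0# - 0#) * 1# + 0#) + coeff p k * (1# * 1# + 0#)
        ≈⟨ solve 2 (λ x y → x :* ((:0 :- :0) :* :1 :+ :0) :+ y :* (:1 :* :1 :+ :0) := y) refl _ _ ⟩
      coeff p k ∎

-- Arithmetic of an ordered field.

module OrderedField (ℝ : CompleteOrderedField) where
  open CompleteOrderedField ℝ hiding (zero) public
  open IsTotalOrder isTotalOrder public
    using (total; antisym) renaming (refl to ≤-refl; reflexive to ≤-reflexive; trans to ≤-trans; isPartialOrder to ≤-isPartialOrder)
  open MatrixAlgebra commutativeRing public
  open IntegerCoefficientSolver commutativeRing public

  ≤-poset : Poset 0ℓ 0ℓ 0ℓ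
  ≤-poset = record { isPartialOrder = ≤-isPartialOrder }

  module ≤-Reasoning = PosetReasoning ≤-poset
  module ≈-Reasoning = SetoidReasoning setoid

  +-mono-≤ : ∀ {a b c d} → a ≤ b → c ≤ d → a + c ≤ b + d
  +-mono-≤ {a} {b} {c} {d} a≤b c≤d = begin
    a + c  ≤⟨ +-monoʳ-≤ a c≤d ⟩
    a + d  ≈⟨ +-comm a d ⟩
    d + a  ≤⟨ +-monoʳ-≤ d a≤b ⟩
    d + b  ≈⟨ +-comm d b ⟩
    b + d  ∎
    where open ≤-Reasoning

  x≤y⇒0≤y-x : ∀ {x y} → x ≤ y → 0# ≤ y - x
  x≤y⇒0≤y-x {x} {y} x≤y = begin
    0#     ≈⟨ -‿inverseʳ x ⟨
    x - x  ≤⟨ +-mono-≤ x≤y ≤-refl ⟩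
    y - x  ∎
    where open ≤-Reasoning

  0≤y-x⇒x≤y : ∀ {x y} → 0# ≤ y - x → x ≤ y
  0≤y-x⇒x≤y {x} {y} 0≤y-x = begin
    x            ≈⟨ +-identityʳ x ⟨
    x + 0#       ≤⟨ +-monoʳ-≤ x 0≤y-x ⟩
    x + (y - x)  ≈⟨ solve 2 (λ x y → x :+ (y :- x) := y) refl x y ⟩
    y            ∎
    where open ≤-Reasoning

  neg-mono-≤ : ∀ {x y} → x ≤ y → - y ≤ - x
  neg-mono-≤ {x} {y} x≤y = 0≤y-x⇒x≤y (≤-trans (x≤y⇒0≤y-x x≤y)
    (≤-reflexive (solve 2 (λ x y → y :- x := :- x :- :- y) refl x y)))

  neg-swap : ∀ {x y} → - x ≤ y → - y ≤ x
  neg-swap {x} {y} -x≤y = ≤-trans (neg-mono-≤ -x≤y) (≤-reflexive (solve 1 (λ x → :- :- x := x)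
       refl x))

  +-nonNeg : ∀ {x y} → 0# ≤ x → 0# ≤ y → 0# ≤ x + y
  +-nonNeg 0≤x 0≤y = ≤-trans (≤-reflexive (sym (+-identityˡ 0#))) (+-mono-≤ 0≤x 0≤y)

  *-monoˡ-≤ : ∀ {c x y} → 0# ≤ c → x ≤ y → c * x ≤ c * y
  *-monoˡ-≤ {c} {x} {y} 0≤c x≤y = 0≤y-x⇒x≤y (≤-trans (*-nonNeg 0≤c (x≤y⇒0≤y-x x≤y))
    (≤-reflexive (solve 3 (λ c x y → c :* (y :- x) := c :* y :- c :* x) refl c x y)))

  x≤y+x : ∀ {x y} → 0# ≤ y → x ≤ y + x
  x≤y+x {x} {y} 0≤y = ≤-trans (≤-reflexive (sym (+-identityˡ x))) (+-mono-≤ 0≤y ≤-refl)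

  x≤x+y : ∀ {x y} → 0# ≤ y → x ≤ x + y
  x≤x+y {x} {y} 0≤y = ≤-trans (x≤y+x 0≤y) (≤-reflexive (+-comm y x))

  square-nonNeg : ∀ x → 0# ≤ x * x
  square-nonNeg x with total 0# x
  ... | inj₁ 0≤x = *-nonNeg 0≤x 0≤x
  ... | inj₂ x≤0 = ≤-trans (*-nonNeg 0≤-x 0≤-x) (≤-reflexive (solve 1 (λ x → :- x :* :- x := x :* x)
       refl x))
    where
    0≤-x : 0# ≤ - x
    0≤-x = ≤-trans (x≤y⇒0≤y-x x≤0) (≤-reflexive (+-identityˡ (- x)))

  0≤1 : 0# ≤ 1#
  0≤1 = ≤-trans (square-nonNeg 1#) (≤-reflexive (*-identityˡ 1#))

  ∑-nonNeg : ∀ {n} {f : Fin n → Carrier} → (∀ i → 0# ≤ f i) → 0# ≤ ∑ f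
  ∑-nonNeg = ∑-inductive {P = 0# ≤_} ≤-refl +-nonNeg

  term≤∑ : ∀ {n} {f : Fin n → Carrier} → (∀ i → 0# ≤ f i) → ∀ i → f i ≤ ∑ f
  term≤∑ {suc n} {f} 0≤f i = ≤-trans (x≤x+y (∑-nonNeg (0≤f ∘ punchIn i))) (≤-reflexive (sym (∑-remove f i)))

-- P-vertices from zeros on the diagonal of the inverse.

module InverseCriterion (em : ExcludedMiddle 0ℓ) (ℝ : CompleteOrderedField) where
  open OrderedField ℝ
  open DeterminantTheory commutativeRing

  private Mat = SquareMatrix Carrier

  *-cancelˡ-0 : ∀ {x y} → x ≉ 0# → x * y ≈ 0# → y ≈ 0#
  *-cancelˡ-0 {x} {y} x≉0 xy≈0 with inverse x x≉0
  ... | x⁻¹ , xx⁻¹≈1 = begin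
    y              ≈⟨ *-identityˡ y ⟨
    1# * y         ≈⟨ *-congʳ xx⁻¹≈1 ⟨
    x * x⁻¹ * y    ≈⟨ solve 3 (λ x z y → x :* z :* y := z :* (x :* y)) refl x x⁻¹ y ⟩
    x⁻¹ * (x * y)  ≈⟨ *-congˡ xy≈0 ⟩
    x⁻¹ * 0#       ≈⟨ zeroʳ x⁻¹ ⟩
    0#             ∎
    where open ≈-Reasoning

  ≈0-stable : ∀ {x} → ¬ (x ≉ 0#) → x ≈ 0#
  ≈0-stable = decidable-stable em

  δ-punchIn : ∀ {n} (i : Fin (suc n)) r s → δ (punchIn i r) (punchIn i s) ≈ δ r s
  δ-punchIn i r s with r ≟ s
  ... | yes ≡.refl = δ-refl (punchIn i r)
  ... | no r≢s     = δ-≢ (r≢s ∘ punchIn-injective i r s)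

  -- The Schur complement of the entry Y j 0.
  minor-rightInverse : ∀ {n} (M Y : Mat (suc n)) → M ∙ Y ≋ δ → ∀ j → Y j zero ≉ 0# →
                       ∃[ Z ] minor M zero j ∙ Z ≋ δ
  minor-rightInverse {n} M Y MY≋δ j y≉0 with inverse (Y j zero) y≉0
  ... | y⁻¹ , yy⁻¹≈1 = Z , λ a b → begin
    ∑ (λ l → minor M zero j a l * Z l b)     ≈⟨ +-identityˡ _ ⟨
    0# + ∑ (λ l → h a b (punchIn j l))       ≈⟨ +-congʳ (h-j a b) ⟨
    h a b j + ∑ (λ l → h a b (punchIn j l))  ≈⟨ ∑-remove (h a b) j ⟨
    ∑ (h a b)
      ≈⟨ ∑-cong (λ l → solve 4 (λ m y y₀ c → m :* (y :- y₀ :* c) := m :* y :+ m :* y₀ :* :- c)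
           refl (M (suc a) l) (Y l (suc b)) (Y l zero) (c b)) ⟩
    ∑ (λ l → M (suc a) l * Y l (suc b) + M (suc a) l * Y l zero * - c b)
      ≈⟨ ∑-distrib-+ (λ l → M (suc a) l * Y l (suc b)) (λ l → M (suc a) l * Y l zero * - c b) ⟩
    (M ∙ Y) (suc a) (suc b) + ∑ (λ l → M (suc a) l * Y l zero * - c b)
      ≈⟨ +-congˡ (*-distribʳ-∑ (- c b) (λ l → M (suc a) l * Y l zero)) ⟨
    (M ∙ Y) (suc a) (suc b) + (M ∙ Y) (suc a) zero * - c b
      ≈⟨ +-cong (MY≋δ (suc a) (suc b)) (*-congʳ (MY≋δ (suc a) zero)) ⟩
    δ a b + 0# * - c b
      ≈⟨ solve 2 (λ d c → d :+ :0 :* :- c := d) refl _ _ ⟩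
    δ a b ∎
    where
    open ≈-Reasoning
    c : Fin n → Carrier
    c b = y⁻¹ * Y j (suc b)
    Z : Mat n
    Z l b = Y (punchIn j l) (suc b) - Y (punchIn j l) zero * c b
    h : Fin n → Fin n → Fin (suc n) → Carrier
    h a b l = M (suc a) l * (Y l (suc b) - Y l zero * c b)
    h-j : ∀ a b → h a b j ≈ 0#
    h-j a b = begin
      M (suc a) j * (Y j (suc b) - Y j zero * (y⁻¹ * Y j (suc b)))
        ≈⟨ solve 4 (λ m y y₀ z → m :* (y :- y₀ :* (z :* y)) := m :* ((:1 :- y₀ :* z) :* y))
             refl (M (suc a) j) (Y j (suc b)) (Y j zero) y⁻¹ ⟩
      M (suc a) j * ((1# - Y j zero * y⁻¹) * Y j (suc b))
        ≈⟨ *-congˡ (*-congʳ (+-congˡ (-‿cong yy⁻¹≈1))) ⟩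
      M (suc a) j * ((1# - 1#) * Y j (suc b))
        ≈⟨ solve 2 (λ m y → m :* ((:1 :- :1) :* y) := :0) refl (M (suc a) j) (Y j (suc b)) ⟩
      0# ∎

  -- If det M = 0, then `cofactor-inverse` kills all first-row cofactors. A nonzero entry Y j 0
  -- would make the corresponding minor right-invertible, against the induction hypothesis. So the
  -- first column of Y is zero, contradicting (M Y) 0 0 = 1.
  rightInverse⇒det≉0 : ∀ {n} (M Y : Mat n) → M ∙ Y ≋ δ → det M ≉ 0#
  rightInverse⇒det≉0 {zero}  M Y MY≋δ detM≈0 = 1≉0 detM≈0
  rightInverse⇒det≉0 {suc n} M Y MY≋δ detM≈0 = 1≉0 (begin
    1#                               ≈⟨ MY≋δ zero zero ⟨
    ∑ (λ j → M zero j * Y j zero)    ≈⟨ ∑-0 (λ j → trans (*-congˡ (column≈0 j)) (zeroʳ _)) ⟩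
    0#                               ∎)
    where
    open ≈-Reasoning
    sgn≉0 : ∀ k → sgn k ≉ 0#
    sgn≉0 k sgn≈0 = 1≉0 (trans (sym (sgn-double k)) (trans (sgn-+ k k) (trans (*-congʳ sgn≈0) (zeroˡ _))))
    column≈0 : ∀ j → Y j zero ≈ 0#
    column≈0 j = ≈0-stable λ y≉0 →
      let Z , NZ≋δ = minor-rightInverse M Y MY≋δ j y≉0 in
      rightInverse⇒det≉0 (minor M zero j) Z NZ≋δ
        (*-cancelˡ-0 (sgn≉0 (toℕ j ℕ.+ 0))
          (trans (cofactor-inverse M Y MY≋δ zero j) (trans (*-congʳ detM≈0) (zeroˡ _))))

  -- By symmetry (X²)ᵢᵢ is the sum of the squares in column i of X. If it is zero, the whole column
  -- is zero and (A X)ᵢᵢ cannot be 1.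
  rightInverse⇒squareDiagonal≉0 : ∀ {n} (A X : Mat n) → A ∙ X ≋ δ → X ᵀ ≋ X → ∀ i → (X ∙ X) i i ≉ 0#
  rightInverse⇒squareDiagonal≉0 A X AX≋δ X-sym i XX≈0 = 1≉0 (begin
    1#                         ≈⟨ δ-refl i ⟨
    δ i i                      ≈⟨ AX≋δ i i ⟨
    ∑ (λ j → A i j * X j i)    ≈⟨ ∑-0 (λ j → trans (*-congˡ (X≈0 j)) (zeroʳ _)) ⟩
    0#                         ∎)
    where
    open ≈-Reasoning
    square : ∀ j → X i j * X j i ≈ X j i * X j i
    square j = *-congʳ (X-sym j i)
    term-nonNeg : ∀ j → 0# ≤ X i j * X j i
    term-nonNeg j = ≤-trans (square-nonNeg (X j i)) (≤-reflexive (sym (square j)))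
    X≈0 : ∀ j → X j i ≈ 0#
    X≈0 j = ≈0-stable λ x≉0 → x≉0 (*-cancelˡ-0 x≉0
      (trans (sym (square j)) (antisym (≤-trans (term≤∑ term-nonNeg j) (≤-reflexive XX≈0)) (term-nonNeg j))))

  module _ where
    open DualNumbers commutativeRing
    open PolynomialCoefficients commutativeRing
    open Polynomial rawRing using (polyRawRing; coeff; Poly)
    open CharacteristicPolynomial rawRing using (charPoly)
    private
      module D where
        open CommutativeRing dualNumbers public
        open MatrixAlgebra dualNumbers public
        open DeterminantTheory dualNumbers public

    -- Reduction modulo X², with X sent to ε.
    truncation : Poly → D.Carrier
    truncation p = coeff p 0 , coeff p 1

    truncation-homo : PreservesRingOperations polyRawRing dualNumbers truncation
    truncation-homo = record
      { +-homo = λ p q → coeff-+ p q 0 , coeff-+ p q 1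
      ; *-homo = λ p q → coeff-*-0 p q , coeff-*-1 p q
      ; -‿homo = λ p → coeff-neg p 0 , coeff-neg p 1
      ; 0-homo = refl , refl
      ; 1-homo = refl , refl
      }

    realPart-homo : PreservesRingOperations D.rawRing commutativeRing proj₁
    realPart-homo = record
      { +-homo = λ _ _ → refl
      ; *-homo = λ _ _ → refl
      ; -‿homo = λ _ → refl
      ; 0-homo = refl
      ; 1-homo = refl
      }

    ∑-components : ∀ {n} (f : Fin n → D.Carrier) → D.∑ f D.≈ (∑ (proj₁ ∘ f) , ∑ (proj₂ ∘ f))
    ∑-components f =
      trans (reflexive (≡.cong proj₁ (D.∑≡sum f))) (∑-homo D.rawRing proj₁ (λ _ _ → refl) refl f) ,
      trans (reflexive (≡.cong proj₂ (D.∑≡sum f))) (∑-homo D.rawRing proj₂ (λ _ _ → refl) refl f)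

    δ-components : ∀ {n} (i j : Fin n) → D.δ i j D.≈ (δ i j , 0#)
    δ-components i j with i ≟ j
    ... | yes _ = refl , refl
    ... | no _  = refl , refl

    -- ε I − A, which is the characteristic matrix modulo ε².
    infinitesimalPencil : ∀ {n} → Mat n → SquareMatrix D.Carrier n
    infinitesimalPencil A i j = - A i j , δ i j

    charPoly-truncation : ∀ {n} (A : Mat n) → truncation (charPoly A) D.≈ D.det (infinitesimalPencil A)
    charPoly-truncation A = D.trans (DeterminantHomomorphism.det-homo truncation-homo entry) (D.det-cong entries)
      where
      open Polynomial rawRing using (_+ₚ_; X; constant)
      entry : SquareMatrix Poly _
      entry i j = (if does (i ≟ j) then X else []) +ₚ map (-_) (constant (A i j))
      entries : (λ i j → truncation (entry i j)) D.≋ infinitesimalPencil A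
      entries i j with i ≟ j
      ... | yes _ = +-identityˡ _ , refl
      ... | no _  = refl , refl

    module _ {n} (A X : Mat n) (AX≋δ : A ∙ X ≋ δ) where

      -- A geometric series cut off at ε² = 0: from ε I - A = -A (1 - ε X), the inverse is -(1 + ε
      -- X) X.
      pencilInverse : SquareMatrix D.Carrier n
      pencilInverse i j = - X i j , - (X ∙ X) i j

      pencil-rightInverse : infinitesimalPencil A D.∙ pencilInverse D.≋ D.δ
      pencil-rightInverse i j = D.trans (∑-components (λ k → infinitesimalPencil A i k D.* pencilInverse k j))
        (D.trans (real , infinitesimal) (D.sym (δ-components i j)))
        where
        open ≈-Reasoning
        real : ∑ (λ k → - A i k * - X k j) ≈ δ i j
        real = trans (∑-cong λ k → solve 2 (λ a x → :- a :* :- x := a :* x)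
             refl (A i k) (X k j)) (AX≋δ i j)
        infinitesimal : ∑ (λ k → - A i k * - (X ∙ X) k j + δ i k * - X k j) ≈ 0#
        infinitesimal = begin
          ∑ (λ k → - A i k * - (X ∙ X) k j + δ i k * - X k j)
            ≈⟨ ∑-distrib-+ (λ k → - A i k * - (X ∙ X) k j) (λ k → δ i k * - X k j) ⟩
          ∑ (λ k → - A i k * - (X ∙ X) k j) + ∑ (λ k → δ i k * - X k j)
            ≈⟨ +-cong (∑-cong λ k → solve 2 (λ a x → :- a :* :- x := a :* x)
                 refl (A i k) ((X ∙ X) k j)) (∑-δˡ i (λ k → - X k j)) ⟩
          (A ∙ (X ∙ X)) i j - X i j
            ≈⟨ +-congʳ (∙-assoc A X X i j) ⟨
          (A ∙ X ∙ X) i j - X i j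
            ≈⟨ +-congʳ (∙-congʳ X AX≋δ i j) ⟩
          (δ ∙ X) i j - X i j
            ≈⟨ +-congʳ (∙-identityˡ X i j) ⟩
          X i j - X i j
            ≈⟨ -‿inverseʳ _ ⟩
          0# ∎

      realPart-det≉0 : proj₁ (D.det (infinitesimalPencil A)) ≉ 0#
      realPart-det≉0 d≈0 = rightInverse⇒det≉0 (λ i j → - A i j) (λ i j → - X i j)
        (λ i j → trans (∑-cong λ k → solve 2 (λ a x → :- a :* :- x := a :* x)
             refl (A i k) (X k j)) (AX≋δ i j))
        (trans (sym (DeterminantHomomorphism.det-homo realPart-homo (infinitesimalPencil A))) d≈0)

    -- With ε² = 0, the inverse of ε I − A is −(X + ε X²). As X i i = 0, deleting
    -- i turns det (ε I − A) into −ε (X²) i i det (ε I − A), a simple zero at ε = 0.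
    inverseDiagonal≈0⇒PVertex : ∀ {n} (A X : Mat (suc n)) → A ∙ X ≋ δ → X ᵀ ≋ X →
                                ∀ i → X i i ≈ 0# → IsPVertex ℝ A i
    inverseDiagonal≈0⇒PVertex A X AX≋δ X-sym i Xᵢᵢ≈0 =
      1 , 0 ,
      simpleRoot (charPoly (A ⟨ i ⟩)) coeff₀≈0 coeff₁≉0 ,
      simpleNonRoot (charPoly A) (λ e → d₀≉0 (trans (sym (proj₁ (charPoly-truncation A))) e)) ,
      ≡.refl
      where
      open ≈-Reasoning
      d = D.det (infinitesimalPencil A)
      d₀≉0 : proj₁ d ≉ 0#
      d₀≉0 = realPart-det≉0 A X AX≋δ
      truncated : truncation (charPoly (A ⟨ i ⟩)) D.≈ d D.* (- X i i , - (X ∙ X) i i)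
      truncated = D.trans (charPoly-truncation (A ⟨ i ⟩))
        (D.trans (D.det-cong λ r s → refl , sym (δ-punchIn i r s))
                 (D.principalMinor-inverse (infinitesimalPencil A) (pencilInverse A X AX≋δ)
                                           (pencil-rightInverse A X AX≋δ) i))
      coeff₀≈0 : coeff (charPoly (A ⟨ i ⟩)) 0 ≈ 0#
      coeff₀≈0 = begin
        coeff (charPoly (A ⟨ i ⟩)) 0   ≈⟨ proj₁ truncated ⟩
        proj₁ d * - X i i              ≈⟨ *-congˡ (-‿cong Xᵢᵢ≈0) ⟩
        proj₁ d * - 0#                 ≈⟨ solve 1 (λ x → x :* :- :0 := :0) refl _ ⟩
        0#                             ∎
      coeff₁≉0 : coeff (charPoly (A ⟨ i ⟩)) 1 ≉ 0#
      coeff₁≉0 e = rightInverse⇒squareDiagonal≉0 A X AX≋δ X-sym i (*-cancelˡ-0 d₀≉0 (begin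
        proj₁ d * (X ∙ X) i i
          ≈⟨ solve 3 (λ d s d′ → d :* s := :- (d :* :- s :+ d′ :* :- :0))
               refl (proj₁ d) ((X ∙ X) i i) (proj₂ d) ⟩
        - (proj₁ d * - (X ∙ X) i i + proj₂ d * - 0#)
          ≈⟨ -‿cong (+-congˡ (*-congˡ (-‿cong Xᵢᵢ≈0))) ⟨
        - (proj₁ d * - (X ∙ X) i i + proj₂ d * - X i i)
          ≈⟨ -‿cong (proj₂ truncated) ⟨
        - coeff (charPoly (A ⟨ i ⟩)) 1
          ≈⟨ -‿cong e ⟩
        - 0#
          ≈⟨ solve 0 (:- :0 := :0) refl ⟩
        0# ∎))

-- Fixed points of small multiples of bounded Lipschitz maps.

module FixedPoints (ℝ : CompleteOrderedField) where
  open OrderedField ℝ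

  infix 4 _⊑_
  _⊑_ : ∀ {I : Set} → (I → Carrier) → (I → Carrier) → Set
  x ⊑ y = ∀ i → x i ≤ y i

  -- Suprema of post-fixed points are formed coordinate by coordinate, so completeness of the line
  -- suffices. That the fixed point is the greatest one is used later to compare the two halves of a
  -- pair.
  module Tarski {I : Set} (H : (I → Carrier) → (I → Carrier)) (lo hi : I → Carrier)
    (lo⊑hi  : lo ⊑ hi)
    (H-mono : ∀ {x y} → lo ⊑ x → x ⊑ y → y ⊑ hi → H x ⊑ H y)
    (lo⊑Hlo : lo ⊑ H lo)
    (Hhi⊑hi : H hi ⊑ hi)
    where

    PostFixed : (I → Carrier) → Set
    PostFixed x = lo ⊑ x × x ⊑ hi × x ⊑ H x

    private
      Value : I → Carrier → Set
      Value i v = ∃[ x ] PostFixed x × x i ≈ v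

      supremum : ∀ i → ∃[ s ] IsUpperBound (Value i) s × (∀ u → IsUpperBound (Value i) u → s ≤ u)
      supremum i = complete (Value i)
        (lo i , lo , ((λ _ → ≤-refl) , lo⊑hi , lo⊑Hlo) , refl)
        (hi i , λ { v (x , (_ , x⊑hi , _) , xᵢ≈v) → ≤-trans (≤-reflexive (sym xᵢ≈v)) (x⊑hi i) })

    gfp : I → Carrier
    gfp i = proj₁ (supremum i)

    gfp-greatest : ∀ {x} → PostFixed x → x ⊑ gfp
    gfp-greatest {x} x-post i = proj₁ (proj₂ (supremum i)) (x i) (x , x-post , refl)

    private
      gfp-least : ∀ i u → (∀ {x} → PostFixed x → x i ≤ u) → gfp i ≤ u
      gfp-least i u bound = proj₂ (proj₂ (supremum i)) u
        λ { v (x , x-post , xᵢ≈v) → ≤-trans (≤-reflexive (sym xᵢ≈v)) (bound x-post) }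

    lo⊑gfp : lo ⊑ gfp
    lo⊑gfp = gfp-greatest ((λ _ → ≤-refl) , lo⊑hi , lo⊑Hlo)

    gfp⊑hi : gfp ⊑ hi
    gfp⊑hi i = gfp-least i (hi i) λ (_ , x⊑hi , _) → x⊑hi i

    private
      gfp⊑Hgfp : gfp ⊑ H gfp
      gfp⊑Hgfp i = gfp-least i (H gfp i) λ x-post@(lo⊑x , _ , x⊑Hx) →
        ≤-trans (x⊑Hx i) (H-mono lo⊑x (gfp-greatest x-post) gfp⊑hi i)

      Hgfp-post : PostFixed (H gfp)
      Hgfp-post = lo⊑Hgfp , Hgfp⊑hi , H-mono lo⊑gfp gfp⊑Hgfp Hgfp⊑hi
        where
        lo⊑Hgfp : lo ⊑ H gfp
        lo⊑Hgfp i = ≤-trans (lo⊑gfp i) (gfp⊑Hgfp i)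
        Hgfp⊑hi : H gfp ⊑ hi
        Hgfp⊑hi i = ≤-trans (H-mono lo⊑gfp gfp⊑hi (λ _ → ≤-refl) i) (Hhi⊑hi i)

    gfp-fixed : ∀ i → H gfp i ≈ gfp i
    gfp-fixed i = antisym (gfp-greatest Hgfp-post i) (gfp⊑Hgfp i)

  Within : Carrier → Carrier → Set
  Within m a = - m ≤ a × a ≤ m

  within-cong : ∀ {m a b} → a ≈ b → Within m a → Within m b
  within-cong a≈b (l , u) = ≤-trans l (≤-reflexive a≈b) , ≤-trans (≤-reflexive (sym a≈b)) u

  within-congᵐ : ∀ {m m′ a} → m ≈ m′ → Within m a → Within m′ a
  within-congᵐ m≈m′ (l , u) =
    ≤-trans (≤-reflexive (-‿cong (sym m≈m′))) l , ≤-trans u (≤-reflexive m≈m′)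

  within-0 : ∀ {m} → 0# ≤ m → Within m 0#
  within-0 0≤m = ≤-trans (neg-mono-≤ 0≤m) (≤-reflexive (solve 0 (:- :0 := :0) refl)) , 0≤m

  within-weaken : ∀ {m m′ a} → m ≤ m′ → Within m a → Within m′ a
  within-weaken m≤m′ (l , u) = ≤-trans (neg-mono-≤ m≤m′) l , ≤-trans u m≤m′

  absolute : ∀ c → ∃[ m ] 0# ≤ m × Within m c
  absolute c with total 0# c
  ... | inj₁ 0≤c = c , 0≤c , ≤-trans (proj₁ (within-0 0≤c)) 0≤c , ≤-refl
  ... | inj₂ c≤0 = - c , 0≤-c , ≤-reflexive (solve 1 (λ c → :- :- c := c) refl c) , ≤-trans c≤0 0≤-c
    where
    0≤-c : 0# ≤ - c
    0≤-c = ≤-trans (≤-reflexive (solve 0 (:0 := :- :0) refl)) (neg-mono-≤ c≤0)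

  within-+ : ∀ {m k a b} → Within m a → Within k b → Within (m + k) (a + b)
  within-+ {m} {k} (la , ua) (lb , ub) =
    ≤-trans (≤-reflexive (solve 2 (λ m k → :- (m :+ k) := :- m :+ :- k)
         refl m k)) (+-mono-≤ la lb) , +-mono-≤ ua ub

  within-neg : ∀ {m a} → Within m a → Within m (- a)
  within-neg (l , u) = neg-mono-≤ u , neg-swap l

  *-upper : ∀ {m k a b} → 0# ≤ k → 0# ≤ a → a ≤ m → b ≤ k → a * b ≤ m * k
  *-upper {m} {k} {a} {b} 0≤k 0≤a a≤m b≤k = begin
    a * b  ≤⟨ *-monoˡ-≤ 0≤a b≤k ⟩
    a * k  ≈⟨ *-comm a k ⟩
    k * a  ≤⟨ *-monoˡ-≤ 0≤k a≤m ⟩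
    k * m  ≈⟨ *-comm k m ⟩
    m * k  ∎
    where open ≤-Reasoning

  within-*-nonNeg : ∀ {m k a b} → 0# ≤ k → 0# ≤ a → a ≤ m → Within k b → Within (m * k) (a * b)
  within-*-nonNeg {a = a} {b} 0≤k 0≤a a≤m (l , u) =
    neg-swap (≤-trans (≤-reflexive (solve 2 (λ a b → :- (a :* b) := a :* :- b) refl a b))
                      (*-upper 0≤k 0≤a a≤m (neg-swap l))) ,
    *-upper 0≤k 0≤a a≤m u

  within-* : ∀ {m k a b} → 0# ≤ k → Within m a → Within k b → Within (m * k) (a * b)
  within-* {a = a} {b} 0≤k (l , u) wb with total 0# a
  ... | inj₁ 0≤a = within-*-nonNeg 0≤k 0≤a u wb
  ... | inj₂ a≤0 = within-cong (solve 2 (λ a b → :- (:- a :* b) := a :* b) refl a b)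
      (within-neg (within-*-nonNeg 0≤k 0≤-a (neg-swap l) wb))
    where
    0≤-a : 0# ≤ - a
    0≤-a = ≤-trans (≤-reflexive (solve 0 (:0 := :- :0) refl)) (neg-mono-≤ a≤0)

  ∑-sub : ∀ {n} (f g : Fin n → Carrier) → ∑ (λ i → f i - g i) ≈ ∑ f - ∑ g
  ∑-sub f g = begin
    ∑ (λ i → f i - g i)              ≈⟨ ∑-cong (λ i → solve 2 (λ f g → f :- g := f :+ :- :1 :* g)
         refl (f i) (g i)) ⟩
    ∑ (λ i → f i + - 1# * g i)       ≈⟨ ∑-distrib-+ f (λ i → - 1# * g i) ⟩
    ∑ f + ∑ (λ i → - 1# * g i)       ≈⟨ +-congˡ (*-distribˡ-∑ (- 1#) g) ⟨
    ∑ f + - 1# * ∑ g                 ≈⟨ solve 2 (λ f g → f :+ :- :1 :* g := f :- g)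
         refl (∑ f) (∑ g) ⟩
    ∑ f - ∑ g                        ∎
    where open ≈-Reasoning

  ∑-mono : ∀ {n} {f g : Fin n → Carrier} → f ⊑ g → ∑ f ≤ ∑ g
  ∑-mono {f = f} {g} f⊑g = 0≤y-x⇒x≤y (≤-trans (∑-nonNeg (x≤y⇒0≤y-x ∘ f⊑g)) (≤-reflexive (∑-sub g f)))

  ∑-bound : ∀ {n} {f : Fin n → Carrier} c → (∀ i → f i ≤ c) → ∑ f ≤ c * ∑ {n} (λ _ → 1#)
  ∑-bound {n} {f} c f≤c = begin
    ∑ f                        ≤⟨ ∑-mono f≤c ⟩
    ∑ {n} (λ _ → c)            ≈⟨ ∑-cong {n} (λ _ → *-identityʳ c) ⟨
    ∑ {n} (λ _ → c * 1#)       ≈⟨ *-distribˡ-∑ c (λ _ → 1#) ⟨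
    c * ∑ {n} (λ _ → 1#)       ∎
    where open ≤-Reasoning

  Box : ∀ {I : Set} → (I → Carrier) → Set
  Box x = ∀ i → Within 1# (x i)

  -- Bounded and Lipschitz on the box, the latter for comparable arguments only,
  -- where the ℓ¹-distance needs no absolute values.
  record Tame {n} (f : (Fin n → Carrier) → Carrier) : Set where
    field
      bound     : Carrier
      0≤bound   : 0# ≤ bound
      bounded   : ∀ {x} → Box x → Within bound (f x)
      lipschitz : ∀ {x y} → Box x → Box y → x ⊑ y → Within (bound * ∑ (λ j → y j - x j)) (f y - f x)

  open Tame

  module _ {n : ℕ} where
    private
      variable f g : (Fin n → Carrier) → Carrier

      distance : (x y : Fin n → Carrier) → Carrier
      distance x y = ∑ λ j → y j - x j

      0≤distance : ∀ {x y} → x ⊑ y → 0# ≤ distance x y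
      0≤distance x⊑y = ∑-nonNeg (x≤y⇒0≤y-x ∘ x⊑y)

    tame-resp : (∀ x → f x ≈ g x) → Tame f → Tame g
    tame-resp f≈g t = record
      { bound     = bound t
      ; 0≤bound   = 0≤bound t
      ; bounded   = λ x → within-cong (f≈g _) (bounded t x)
      ; lipschitz = λ bx by x⊑y → within-cong (+-cong (f≈g _) (-‿cong (f≈g _))) (lipschitz t bx by x⊑y)
      }

    tame-const : ∀ c → Tame {n} (const c)
    tame-const c = record
      { bound     = proj₁ (absolute c)
      ; 0≤bound   = proj₁ (proj₂ (absolute c))
      ; bounded   = λ _ → proj₂ (proj₂ (absolute c))
      ; lipschitz = λ _ _ x⊑y → within-cong (sym (-‿inverseʳ c))
                      (within-0 (*-nonNeg (proj₁ (proj₂ (absolute c))) (0≤distance x⊑y)))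
      }

    tame-lookup : ∀ j → Tame {n} (λ x → x j)
    tame-lookup j = record
      { bound     = 1#
      ; 0≤bound   = 0≤1
      ; bounded   = λ bx → bx j
      ; lipschitz = λ _ _ x⊑y →
          ≤-trans (proj₁ (within-0 (*-nonNeg 0≤1 (0≤distance x⊑y)))) (x≤y⇒0≤y-x (x⊑y j)) ,
          ≤-trans (term≤∑ (x≤y⇒0≤y-x ∘ x⊑y) j) (≤-reflexive (sym (*-identityˡ _)))
      }

    tame-+ : Tame f → Tame g → Tame (λ x → f x + g x)
    tame-+ {f} {g} s t = record
      { bound     = bound s + bound t
      ; 0≤bound   = +-nonNeg (0≤bound s) (0≤bound t)
      ; bounded   = λ bx → within-+ (bounded s bx) (bounded t bx)
      ; lipschitz = λ {x} {y} bx by x⊑y → within-congᵐ (sym (distribʳ _ _ _))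
          (within-cong (solve 4 (λ a b c d → (a :- b) :+ (c :- d) := (a :+ c) :- (b :+ d))
               refl (f y) (f x) (g y) (g x))
            (within-+ (lipschitz s bx by x⊑y) (lipschitz t bx by x⊑y)))
      }

    -- Split f y g y - f x g x as f y (g y - g x) + (f y - f x) g x. Each summand costs one product
    -- of the bounds, hence the doubled constant.
    tame-* : Tame f → Tame g → Tame (λ x → f x * g x)
    tame-* {f} {g} s t = record
      { bound     = bound s * bound t + bound s * bound t
      ; 0≤bound   = +-nonNeg 0≤st 0≤st
      ; bounded   = λ bx → within-weaken (x≤x+y 0≤st) (within-* (0≤bound t) (bounded s bx) (bounded t bx))
      ; lipschitz = λ {x} {y} bx by x⊑y → within-congᵐ
          (solve 3 (λ s t d → s :* (t :* d) :+ s :* d :* t := (s :* t :+ s :* t) :* d)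
               refl (bound s) (bound t) (distance x y))
          (within-cong (solve 4 (λ a b c d → a :* (c :- d) :+ (a :- b) :* d := a :* c :- b :* d)
               refl (f y) (f x) (g y) (g x))
            (within-+ (within-* (*-nonNeg (0≤bound t) (0≤distance x⊑y)) (bounded s by) (lipschitz t bx by x⊑y))
                      (within-* (0≤bound t) (lipschitz s bx by x⊑y) (bounded t bx))))
      }
      where
      0≤st : 0# ≤ bound s * bound t
      0≤st = *-nonNeg (0≤bound s) (0≤bound t)

    tame-neg : Tame f → Tame (λ x → - f x)
    tame-neg {f} t = tame-resp (λ x → solve 1 (λ a → :- :1 :* a := :- a)
         refl (f x)) (tame-* (tame-const (- 1#)) t)

    tame-∑ : ∀ {m} {F : Fin m → (Fin n → Carrier) → Carrier} →
             (∀ i → Tame (F i)) → Tame (λ x → ∑ (λ i → F i x))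
    tame-∑ {zero}      t = tame-resp (λ _ → sym (∑-0 λ ())) (tame-const 0#)
    tame-∑ {suc m} {F} t = tame-resp (λ x → sym (∑-remove (λ i → F i x) zero)) (tame-+ (t zero) (tame-∑ (t ∘ suc)))

  module SmallScaleFixedPoint {n} {Ψ : Fin n → (Fin n → Carrier) → Carrier} (tame : ∀ i → Tame (Ψ i))
    (B : Carrier) (0≤B : 0# ≤ B) where

    private
      -- M is a common bound and Lipschitz constant for all `Ψ i`; D₁ is n, which bounds sums over
      -- the box. K dominates M + 2 M D₁, which keeps `G` in the box, 3 M D₁, which makes the gap
      -- contract, and B, which keeps 1 + ε c away from zero.
      M D₁ K : Carrier
      M  = ∑ (bound ∘ tame)
      D₁ = ∑ {n} (λ _ → 1#)
      K  = (M + (M * D₁ + M * D₁ + M * D₁)) + B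

      0≤M : 0# ≤ M
      0≤M = ∑-nonNeg (0≤bound ∘ tame)

      0≤MD₁ : 0# ≤ M * D₁
      0≤MD₁ = *-nonNeg 0≤M (∑-nonNeg {n} λ _ → 0≤1)

      0≤K : 0# ≤ K
      0≤K = +-nonNeg (+-nonNeg 0≤M (+-nonNeg (+-nonNeg 0≤MD₁ 0≤MD₁) 0≤MD₁)) 0≤B

      1+K≉0 : 1# + K ≉ 0#
      1+K≉0 e = 1≉0 (antisym (≤-trans (x≤x+y 0≤K) (≤-reflexive e)) 0≤1)

    -- With ε = 1 / (1 + K) one has ε K = 1 - ε, so whatever K dominates is scaled strictly below 1.
    ε : Carrier
    ε = proj₁ (inverse (1# + K) 1+K≉0)

    private
      [1+K]ε≈1 : (1# + K) * ε ≈ 1#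
      [1+K]ε≈1 = proj₂ (inverse (1# + K) 1+K≉0)

      εK≈1-ε : ε * K ≈ 1# - ε
      εK≈1-ε = begin
        ε * K                   ≈⟨ solve 2 (λ ε K → ε :* K := (:1 :+ K) :* ε :- ε) refl ε K ⟩
        (1# + K) * ε - ε        ≈⟨ +-congʳ [1+K]ε≈1 ⟩
        1# - ε                  ∎
        where open ≈-Reasoning

    ε≉0 : ε ≉ 0#
    ε≉0 e = 1≉0 (trans (sym [1+K]ε≈1) (trans (*-congˡ e) (zeroʳ _)))

    0≤ε : 0# ≤ ε
    -- The field inverse carries no sign; it is read off from ε = (1 + K) ε².
    0≤ε = ≤-trans (*-nonNeg (+-nonNeg 0≤1 0≤K) (square-nonNeg ε)) (≤-reflexive (begin
      (1# + K) * (ε * ε)    ≈⟨ *-assoc _ _ _ ⟨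
      (1# + K) * ε * ε      ≈⟨ *-congʳ [1+K]ε≈1 ⟩
      1# * ε                ≈⟨ *-identityˡ ε ⟩
      ε                     ∎))
      where open ≈-Reasoning

    ε*-bound : ∀ {c} → c ≤ K → ε * c ≤ 1# - ε
    ε*-bound c≤K = ≤-trans (*-monoˡ-≤ 0≤ε c≤K) (≤-reflexive εK≈1-ε)

    1-ε≤1 : 1# - ε ≤ 1#
    1-ε≤1 = 0≤y-x⇒x≤y (≤-trans 0≤ε (≤-reflexive (solve 1 (λ ε → ε := :1 :- (:1 :- ε)) refl ε)))

    -- Indeed 1 + ε c ≥ 1 - ε B ≥ ε > 0.
    1+ε*≉0 : ∀ {c} → Within B c → 1# + ε * c ≉ 0#
    1+ε*≉0 {c} (-B≤c , _) e = ε≉0 (antisym ε≤0 0≤ε)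
      where
      open ≤-Reasoning
      B≤K : B ≤ K
      B≤K = x≤y+x (+-nonNeg 0≤M (+-nonNeg (+-nonNeg 0≤MD₁ 0≤MD₁) 0≤MD₁))
      ε≤0 : ε ≤ 0#
      ε≤0 = begin
        ε                   ≈⟨ solve 1 (λ ε → ε := :1 :+ :- (:1 :- ε)) refl ε ⟩
        1# + - (1# - ε)     ≤⟨ +-monoʳ-≤ 1# (neg-mono-≤ (ε*-bound B≤K)) ⟩
        1# + - (ε * B)      ≈⟨ solve 2 (λ ε B → :1 :+ :- (ε :* B) := :1 :+ ε :* :- B) refl ε B ⟩
        1# + ε * - B        ≤⟨ +-monoʳ-≤ 1# (*-monoˡ-≤ 0≤ε -B≤c) ⟩
        1# + ε * c          ≈⟨ e ⟩
        0#                  ∎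

    private
      G : Fin n → (x y : Fin n → Carrier) → Carrier
      G i x y = ε * (Ψ i x + M * (∑ x - ∑ y))

      box-∑ : ∀ {x : Fin n → Carrier} → Box x → Within D₁ (∑ x)
      box-∑ {x} bx =
        ≤-trans (neg-mono-≤ (≤-trans (∑-mono {f = λ i → - x i} λ i → neg-swap (proj₁ (bx i))) ≤-refl))
                (≤-reflexive (begin
                  - ∑ (λ i → - x i)      ≈⟨ -‿cong (∑-cong λ i → solve 1 (λ x → :- x := :0 :- x)
                       refl (x i)) ⟩
                  - ∑ (λ i → 0# - x i)   ≈⟨ -‿cong (∑-sub (λ _ → 0#) x) ⟩
                  - (∑ {n} (λ _ → 0#) - ∑ x) ≈⟨ -‿cong (+-congʳ (∑-0 λ _ → refl)) ⟩
                  - (0# - ∑ x)           ≈⟨ solve 1 (λ s → :- (:0 :- s) := s) refl (∑ x) ⟩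
                  ∑ x                    ∎)) ,
        ∑-mono (proj₂ ∘ bx)
        where open ≈-Reasoning

      Ψ-bounded : ∀ i {x} → Box x → Within M (Ψ i x)
      Ψ-bounded i bx = within-weaken (term≤∑ (0≤bound ∘ tame) i) (bounded (tame i) bx)

      Ψ-lipschitz : ∀ i {x y} → Box x → Box y → x ⊑ y → Within (M * (∑ y - ∑ x)) (Ψ i y - Ψ i x)
      Ψ-lipschitz i {x} {y} bx by x⊑y = within-weaken (begin
        bound (tame i) * D       ≈⟨ *-comm _ _ ⟩
        D * bound (tame i)       ≤⟨ *-monoˡ-≤ (∑-nonNeg (x≤y⇒0≤y-x ∘ x⊑y)) (term≤∑ (0≤bound ∘ tame) i) ⟩
        D * M                    ≈⟨ *-comm _ _ ⟩
        M * D                    ≈⟨ *-congˡ (∑-sub y x) ⟩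
        M * (∑ y - ∑ x)          ∎) (lipschitz (tame i) bx by x⊑y)
        where
        open ≤-Reasoning
        D = ∑ λ j → y j - x j

      G-box : ∀ i {x y} → Box x → Box y → Within 1# (G i x y)
      G-box i {x} {y} bx by = within-weaken (≤-trans (ε*-bound small≤K) 1-ε≤1)
        (within-* (+-nonNeg 0≤M (*-nonNeg 0≤M (+-nonNeg 0≤D₁ 0≤D₁)))
          (≤-trans (proj₁ (within-0 0≤ε)) 0≤ε , ≤-refl)
          (within-+ (Ψ-bounded i bx)
            (within-* (+-nonNeg 0≤D₁ 0≤D₁) (≤-trans (proj₁ (within-0 0≤M)) 0≤M , ≤-refl)
              (within-+ (box-∑ bx) (within-neg (box-∑ by))))))
        where
        open ≤-Reasoning
        0≤D₁ : 0# ≤ D₁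
        0≤D₁ = ∑-nonNeg {n} λ _ → 0≤1
        small≤K : M + M * (D₁ + D₁) ≤ K
        small≤K = begin
          M + M * (D₁ + D₁)                ≤⟨ x≤x+y (+-nonNeg 0≤MD₁ 0≤B) ⟩
          M + M * (D₁ + D₁) + (M * D₁ + B)
            ≈⟨ solve 3 (λ M D B → M :+ M :* (D :+ D) :+ (M :* D :+ B) := (M :+ (M :* D :+ M :* D :+ M :* D)) :+ B)
                 refl M D₁ B ⟩
          K ∎

      G-mono : ∀ i {x x′ y y′} → Box x → Box x′ → x ⊑ x′ → y′ ⊑ y → G i x y ≤ G i x′ y′
      G-mono i {x} {x′} {y} {y′} bx bx′ x⊑x′ y′⊑y = *-monoˡ-≤ 0≤ε (0≤y-x⇒x≤y (begin
        0#
          ≤⟨ +-nonNeg (x≤y⇒0≤y-x (proj₁ (Ψ-lipschitz i bx bx′ x⊑x′)))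
                      (*-nonNeg 0≤M (x≤y⇒0≤y-x (∑-mono y′⊑y))) ⟩
        ((Ψ i x′ - Ψ i x) - - (M * (∑ x′ - ∑ x))) + M * (∑ y - ∑ y′)
          ≈⟨ solve 7 (λ f′ f M s′ s t t′ → ((f′ :- f) :- :- (M :* (s′ :- s))) :+ M :* (t :- t′)
                        := (f′ :+ M :* (s′ :- t′)) :- (f :+ M :* (s :- t))) refl
                     (Ψ i x′) (Ψ i x) M (∑ x′) (∑ x) (∑ y) (∑ y′) ⟩
        (Ψ i x′ + M * (∑ x′ - ∑ y′)) - (Ψ i x + M * (∑ x - ∑ y)) ∎))
        where open ≤-Reasoning

      -- A pair (x , y) is stored as x on the `true` half and -y on the `false` half. The sign turns
      -- monotonicity of mixed type into plain monotonicity of `H`.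
      Index : Set
      Index = Bool × Fin n

      up down : (Index → Carrier) → Fin n → Carrier
      up   z j = z (true , j)
      down z j = - z (false , j)

      H : (Index → Carrier) → (Index → Carrier)
      H z (true  , i) = G i (up z) (down z)
      H z (false , i) = - G i (down z) (up z)

      lo hi : Index → Carrier
      lo _ = - 1#
      hi _ = 1#

      box-up : ∀ {z} → lo ⊑ z → z ⊑ hi → Box (up z)
      box-up lo⊑z z⊑hi j = lo⊑z (true , j) , z⊑hi (true , j)

      box-down : ∀ {z} → lo ⊑ z → z ⊑ hi → Box (down z)
      box-down lo⊑z z⊑hi j = within-neg (lo⊑z (false , j) , z⊑hi (false , j))

      -1≤1 : - 1# ≤ 1#
      -1≤1 = ≤-trans (proj₁ (within-0 0≤1)) 0≤1

      H-box : ∀ {z} → lo ⊑ z → z ⊑ hi → ∀ i → Within 1# (H z i)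
      H-box lo⊑z z⊑hi (true  , i) = G-box i (box-up lo⊑z z⊑hi) (box-down lo⊑z z⊑hi)
      H-box lo⊑z z⊑hi (false , i) = within-neg (G-box i (box-down lo⊑z z⊑hi) (box-up lo⊑z z⊑hi))

      H-mono : ∀ {z w} → lo ⊑ z → z ⊑ w → w ⊑ hi → H z ⊑ H w
      H-mono {z} {w} lo⊑z z⊑w w⊑hi = λ
        { (true  , i) → G-mono i (box-up lo⊑z z⊑hi) (box-up lo⊑w w⊑hi) (λ j → z⊑w _) (λ j → neg-mono-≤ (z⊑w _))
        ; (false , i) → neg-mono-≤ (G-mono i (box-down lo⊑w w⊑hi) (box-down lo⊑z z⊑hi) (λ j → neg-mono-≤ (z⊑w _)) (λ j → z⊑w _))
        }
        where
        z⊑hi : z ⊑ hi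
        z⊑hi i = ≤-trans (z⊑w i) (w⊑hi i)
        lo⊑w : lo ⊑ w
        lo⊑w i = ≤-trans (lo⊑z i) (z⊑w i)

      module T = Tarski H lo hi (λ _ → -1≤1) H-mono
        (λ i → proj₁ (H-box (λ _ → ≤-refl) (λ _ → -1≤1) i))
        (λ i → proj₂ (H-box (λ _ → -1≤1) (λ _ → ≤-refl) i))

      x y : Fin n → Carrier
      x = up T.gfp
      y = down T.gfp

      box-x : Box x
      box-x = box-up T.lo⊑gfp T.gfp⊑hi

      box-y : Box y
      box-y = box-down T.lo⊑gfp T.gfp⊑hi

      x-fixed : ∀ i → x i ≈ G i x y
      x-fixed i = sym (T.gfp-fixed (true , i))

      y-fixed : ∀ i → y i ≈ G i y x
      y-fixed i = trans (-‿cong (sym (T.gfp-fixed (false , i)))) (solve 1 (λ g → :- :- g := g)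
           refl (G i y x))

      -- (y , x) is a fixed pair too, so the greatest one satisfies y ⊑ x.
      y⊑x : y ⊑ x
      y⊑x j = T.gfp-greatest (lo⊑swapped , swapped⊑hi , swapped⊑H) (true , j)
        where
        swapped : Index → Carrier
        swapped (true  , j) = y j
        swapped (false , j) = - x j
        lo⊑swapped : lo ⊑ swapped
        lo⊑swapped (true  , j) = proj₁ (box-y j)
        lo⊑swapped (false , j) = proj₁ (within-neg (box-x j))
        swapped⊑hi : swapped ⊑ hi
        swapped⊑hi (true  , j) = proj₂ (box-y j)
        swapped⊑hi (false , j) = proj₂ (within-neg (box-x j))
        neg-neg : ∀ j → - - x j ≈ x j
        neg-neg j = solve 1 (λ x → :- :- x := x) refl (x j)
        swapped⊑H : swapped ⊑ H swapped
        swapped⊑H (true  , i) = ≤-trans (≤-reflexive (y-fixed i))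
          (G-mono i box-y box-y (λ _ → ≤-refl) (λ j → ≤-reflexive (neg-neg j)))
        swapped⊑H (false , i) = neg-mono-≤ (≤-trans
          (G-mono i (λ j → within-cong (sym (neg-neg j)) (box-x j)) box-x (λ j → ≤-reflexive (neg-neg j)) (λ _ → ≤-refl))
          (≤-reflexive (sym (x-fixed i))))

      gap : Carrier
      gap = ∑ x - ∑ y

      0≤gap : 0# ≤ gap
      0≤gap = x≤y⇒0≤y-x (∑-mono y⊑x)

      -- The correction term changes sign when x and y are exchanged, so the difference contains it
      -- twice; the third M gap is the Lipschitz bound for Ψ.
      x-y≤ : ∀ i → x i - y i ≤ ε * (M * gap + M * gap + M * gap)
      x-y≤ i = begin
        x i - y i
          ≈⟨ +-cong (x-fixed i) (-‿cong (y-fixed i)) ⟩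
        G i x y - G i y x
          ≈⟨ solve 6 (λ ε f g M s t → ε :* (f :+ M :* (s :- t)) :- ε :* (g :+ M :* (t :- s))
                       := ε :* ((f :- g) :+ M :* (s :- t) :+ M :* (s :- t)))
                            refl ε (Ψ i x) (Ψ i y) M (∑ x) (∑ y) ⟩
        ε * ((Ψ i x - Ψ i y) + M * gap + M * gap)
          ≤⟨ *-monoˡ-≤ 0≤ε (+-mono-≤ (+-mono-≤ (proj₂ (Ψ-lipschitz i box-y box-x y⊑x)) ≤-refl) ≤-refl) ⟩
        ε * (M * gap + M * gap + M * gap) ∎
        where open ≤-Reasoning

      -- Summing `x-y≤` over the coordinates gives gap ≤ (1 - ε) gap, so ε gap ≤ 0; the factor ε is
      -- removed by multiplying with 1 + K.
      gap≤0 : gap ≤ 0#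
      gap≤0 = begin
        gap                            ≈⟨ *-identityˡ gap ⟨
        1# * gap                       ≈⟨ *-congʳ [1+K]ε≈1 ⟨
        (1# + K) * ε * gap             ≈⟨ *-assoc _ _ _ ⟩
        (1# + K) * (ε * gap)           ≤⟨ *-monoˡ-≤ (+-nonNeg 0≤1 0≤K) εgap≤0 ⟩
        (1# + K) * 0#                  ≈⟨ zeroʳ _ ⟩
        0#                             ∎
        where
        open ≤-Reasoning
        MD≤K : M * D₁ + M * D₁ + M * D₁ ≤ K
        MD≤K = ≤-trans (x≤y+x 0≤M) (x≤x+y 0≤B)
        contraction : gap ≤ gap * (1# - ε)
        contraction = begin
          gap                                        ≈⟨ ∑-sub x y ⟨
          ∑ (λ i → x i - y i)                        ≤⟨ ∑-bound (ε * (M * gap + M * gap + M * gap)) x-y≤ ⟩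
          ε * (M * gap + M * gap + M * gap) * D₁
            ≈⟨ solve 4 (λ ε M g D → ε :* (M :* g :+ M :* g :+ M :* g) :* D := g :* (ε :* (M :* D :+ M :* D :+ M :* D)))
                 refl ε M gap D₁ ⟩
          gap * (ε * (M * D₁ + M * D₁ + M * D₁))     ≤⟨ *-monoˡ-≤ 0≤gap (ε*-bound MD≤K) ⟩
          gap * (1# - ε)                             ∎
        εgap≤0 : ε * gap ≤ 0#
        εgap≤0 = begin
          ε * gap                    ≈⟨ solve 2 (λ ε g → ε :* g := g :- g :* (:1 :- ε)) refl ε gap ⟩
          gap - gap * (1# - ε)       ≤⟨ +-mono-≤ contraction ≤-refl ⟩
          gap * (1# - ε) - gap * (1# - ε) ≈⟨ -‿inverseʳ _ ⟩
          0#                         ∎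

    fixedPoint : Fin n → Carrier
    fixedPoint = x

    fixedPoint-box : Box fixedPoint
    fixedPoint-box = box-x

    -- A zero gap removes the correction term from `x-fixed`.
    fixedPoint-fixed : ∀ i → fixedPoint i ≈ ε * Ψ i fixedPoint
    fixedPoint-fixed i = begin
      x i                        ≈⟨ x-fixed i ⟩
      ε * (Ψ i x + M * gap)      ≈⟨ *-congˡ (+-congˡ (*-congˡ (antisym gap≤0 0≤gap))) ⟩
      ε * (Ψ i x + M * 0#)       ≈⟨ *-congˡ (solve 2 (λ f M → f :+ M :* :0 := f) refl (Ψ i x) M) ⟩
      ε * Ψ i x                  ∎
      where open ≈-Reasoning

-- Perturbation of a forest of stars.

-- The stars have centres p i = i and leaves p i ≠ i. In the coordinates R x the
-- unperturbed form is diagonal with entries J, and the perturbed one is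
-- M = J + ε F, where F consists of the weights s and of E′ = R⁻ᵀ E R⁻. Its inverse
-- is sought as K = J + ε X₁ with X₁ = −J F J − z. Then M K = 1 says z = ε Ψ(z), and
-- s is chosen, depending on z, such that the diagonal of R⁻ X₁ R⁻ᵀ vanishes at
-- the leaves.
module StarPerturbation (ℝ : CompleteOrderedField) {n} (p : Fin n → Fin n) (p-idem : ∀ i → p (p i) ≡ p i)
  (E : SquareMatrix (CompleteOrderedField.Carrier ℝ) n) where
  open OrderedField ℝ
  open FixedPoints ℝ
  open Tame

  private Mat = SquareMatrix Carrier n

  leaf J : Fin n → Carrier
  leaf i = if does (p i ≟ i) then 0# else 1#
  J    i = if does (p i ≟ i) then - 1# else 1#

  leaf-1 : ∀ {i} → p i ≢ i → leaf i ≈ 1#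
  leaf-1 {i} pi≢i with p i ≟ i
  ... | yes e = contradiction e pi≢i
  ... | no _  = refl

  leaf-0 : ∀ {i} → p i ≡ i → leaf i ≈ 0#
  leaf-0 {i} e with p i ≟ i
  ... | yes _   = refl
  ... | no pi≢i = contradiction e pi≢i

  J-1 : ∀ {i} → p i ≢ i → J i ≈ 1#
  J-1 {i} pi≢i with p i ≟ i
  ... | yes e = contradiction e pi≢i
  ... | no _  = refl

  J--1 : ∀ {i} → p i ≡ i → J i ≈ - 1#
  J--1 {i} e with p i ≟ i
  ... | yes _   = refl
  ... | no pi≢i = contradiction e pi≢i

  J² : ∀ i → J i * J i ≈ 1#
  J² i with p i ≟ i
  ... | yes _ = solve 0 (:- :1 :* :- :1 := :1) refl
  ... | no _  = *-identityˡ 1#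

  -- These are 1 + N and 1 - N with N² = 0: N sends a leaf to its centre, and by `p-idem` a centre
  -- is not a leaf. Row k of R is the linear form x_k + x_(p k) at a leaf and x_k at a centre.
  R R⁻ : Mat
  R  k i = δ k i + leaf k * δ (p k) i
  R⁻ k i = δ k i - leaf k * δ (p k) i

  R-apply : ∀ a (f : Fin n → Carrier) → ∑ (λ k → R a k * f k) ≈ f a + leaf a * f (p a)
  R-apply a f = begin
    ∑ (λ k → R a k * f k)
      ≈⟨ ∑-cong (λ k → solve 4 (λ d u e f → (d :+ u :* e) :* f := d :* f :+ u :* (e :* f))
           refl (δ a k) (leaf a) (δ (p a) k) (f k)) ⟩
    ∑ (λ k → δ a k * f k + leaf a * (δ (p a) k * f k))
      ≈⟨ ∑-distrib-+ (λ k → δ a k * f k) (λ k → leaf a * (δ (p a) k * f k)) ⟩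
    ∑ (λ k → δ a k * f k) + ∑ (λ k → leaf a * (δ (p a) k * f k))
      ≈⟨ +-cong (∑-δˡ a f) (trans (sym (*-distribˡ-∑ (leaf a) (λ k → δ (p a) k * f k))) (*-congˡ (∑-δˡ (p a) f))) ⟩
    f a + leaf a * f (p a) ∎
    where open ≈-Reasoning

  R⁻-apply : ∀ a (f : Fin n → Carrier) → ∑ (λ k → R⁻ a k * f k) ≈ f a - leaf a * f (p a)
  R⁻-apply a f = begin
    ∑ (λ k → R⁻ a k * f k)
      ≈⟨ ∑-cong (λ k → solve 4 (λ d u e f → (d :- u :* e) :* f := d :* f :+ :- u :* (e :* f))
           refl (δ a k) (leaf a) (δ (p a) k) (f k)) ⟩
    ∑ (λ k → δ a k * f k + - leaf a * (δ (p a) k * f k))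
      ≈⟨ ∑-distrib-+ (λ k → δ a k * f k) (λ k → - leaf a * (δ (p a) k * f k)) ⟩
    ∑ (λ k → δ a k * f k) + ∑ (λ k → - leaf a * (δ (p a) k * f k))
      ≈⟨ +-cong (∑-δˡ a f) (trans (sym (*-distribˡ-∑ (- leaf a) (λ k → δ (p a) k * f k))) (*-congˡ (∑-δˡ (p a) f))) ⟩
    f a + - leaf a * f (p a)
      ≈⟨ solve 3 (λ f u g → f :+ :- u :* g := f :- u :* g) refl (f a) (leaf a) (f (p a)) ⟩
    f a - leaf a * f (p a) ∎
    where open ≈-Reasoning

  R∙R⁻ : R ∙ R⁻ ≋ δ
  R∙R⁻ a b = begin
    ∑ (λ k → R a k * R⁻ k b)
      ≈⟨ R-apply a (λ k → R⁻ k b) ⟩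
    (δ a b - leaf a * δ (p a) b) + leaf a * (δ (p a) b - leaf (p a) * δ (p (p a)) b)
      ≈⟨ +-congˡ (*-congˡ (+-congˡ (-‿cong (*-congʳ (leaf-0 (p-idem a)))))) ⟩
    (δ a b - leaf a * δ (p a) b) + leaf a * (δ (p a) b - 0# * δ (p (p a)) b)
      ≈⟨ solve 4 (λ d u e f → (d :- u :* e) :+ u :* (e :- :0 :* f) := d)
           refl (δ a b) (leaf a) (δ (p a) b) (δ (p (p a)) b) ⟩
    δ a b ∎
    where open ≈-Reasoning

  R⁻∙R : R⁻ ∙ R ≋ δ
  R⁻∙R a b = begin
    ∑ (λ k → R⁻ a k * R k b)
      ≈⟨ R⁻-apply a (λ k → R k b) ⟩
    (δ a b + leaf a * δ (p a) b) - leaf a * (δ (p a) b + leaf (p a) * δ (p (p a)) b)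
      ≈⟨ +-congˡ (-‿cong (*-congˡ (+-congˡ (*-congʳ (leaf-0 (p-idem a)))))) ⟩
    (δ a b + leaf a * δ (p a) b) - leaf a * (δ (p a) b + 0# * δ (p (p a)) b)
      ≈⟨ solve 4 (λ d u e f → (d :+ u :* e) :- u :* (e :+ :0 :* f) := d)
           refl (δ a b) (leaf a) (δ (p a) b) (δ (p (p a)) b) ⟩
    δ a b ∎
    where open ≈-Reasoning

  Rᵀ∙R⁻ᵀ : R ᵀ ∙ R⁻ ᵀ ≋ δ
  Rᵀ∙R⁻ᵀ i j = trans (sym (∙-ᵀ R⁻ R i j)) (trans (R⁻∙R j i) (δ-sym j i))

  E′ : Mat
  E′ = R⁻ ᵀ ∙ E ∙ R⁻

  RᵀE′R : R ᵀ ∙ (E′ ∙ R) ≋ E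
  RᵀE′R = begin
    R ᵀ ∙ (R⁻ ᵀ ∙ E ∙ R⁻ ∙ R)      ≈⟨ ∙-congˡ (R ᵀ) (∙-assoc (R⁻ ᵀ ∙ E) R⁻ R) ⟩
    R ᵀ ∙ (R⁻ ᵀ ∙ E ∙ (R⁻ ∙ R))    ≈⟨ ∙-congˡ (R ᵀ) (∙-congˡ (R⁻ ᵀ ∙ E) R⁻∙R) ⟩
    R ᵀ ∙ (R⁻ ᵀ ∙ E ∙ δ)           ≈⟨ ∙-congˡ (R ᵀ) (∙-identityʳ (R⁻ ᵀ ∙ E)) ⟩
    R ᵀ ∙ (R⁻ ᵀ ∙ E)               ≈⟨ ∙-assoc (R ᵀ) (R⁻ ᵀ) E ⟨
    R ᵀ ∙ R⁻ ᵀ ∙ E                 ≈⟨ ∙-congʳ E Rᵀ∙R⁻ᵀ ⟩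
    δ ∙ E                          ≈⟨ ∙-identityˡ E ⟩
    E                              ∎
    where open ≋-Reasoning

  -- The entry (R⁻ M R⁻ᵀ) a a at a leaf a.
  leafEntry : Mat → Fin n → Carrier
  leafEntry M a = (M a a - M a (p a)) - (M (p a) a - M (p a) (p a))

  Unknown : Set
  Unknown = Fin (n ℕ.* n) → Carrier

  entry : Unknown → Mat
  entry z i j = z (combine i j)

  -- This solves `leafEntry (X₁ z) a` = 0. In X₁ the weights occur only on the diagonal, as -J s J =
  -- -s, and they vanish at centres, so the equation is linear in s a with coefficient -1. The
  -- solution is affine in z, which makes Ψ quadratic.
  s : Unknown → Fin n → Carrier
  s z a = leaf a * - (leafEntry (λ i j → J i * E′ i j * J j) a + leafEntry (entry z) a)

  -- As J² = 1, expanding (J + ε F)(J + ε X₁) gives 1 - ε J z + ε² F X₁: the choice of X₁ cancels F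
  -- J in order ε. The product is 1 exactly when z = ε J F X₁.
  F X₁ Ψ : Unknown → Mat
  F  z i j = E′ i j + δ i j * s z i
  X₁ z i j = - (J i * F z i j * J j) - entry z i j
  Ψ  z i j = J i * (F z ∙ X₁ z) i j

  tame-s : ∀ a → Tame (λ z → s z a)
  tame-s a = tame-* (tame-const (leaf a)) (tame-neg (tame-+ (tame-const (leafEntry (λ i j → J i * E′ i j * J j) a))
    (tame-+ (tame-+ (tame-lookup _) (tame-neg (tame-lookup _)))
            (tame-neg (tame-+ (tame-lookup _) (tame-neg (tame-lookup _)))))))

  tame-F : ∀ i j → Tame (λ z → F z i j)
  tame-F i j = tame-+ (tame-const (E′ i j)) (tame-* (tame-const (δ i j)) (tame-s i))

  tame-X₁ : ∀ i j → Tame (λ z → X₁ z i j)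
  tame-X₁ i j = tame-+ (tame-neg (tame-* (tame-* (tame-const (J i)) (tame-F i j)) (tame-const (J j))))
                       (tame-neg (tame-lookup (combine i j)))

  tame-Ψ : ∀ i j → Tame (λ z → Ψ z i j)
  tame-Ψ i j = tame-* (tame-const (J i)) (tame-∑ λ k → tame-* (tame-F i k) (tame-X₁ k j))

  private
    tame-1+s : ∀ i → Tame (λ z → s z i + 1#)
    tame-1+s i = tame-+ (tame-s i) (tame-const 1#)

    module Solution = SmallScaleFixedPoint
      {Ψ = λ k z → Ψ z (quotient n k) (remainder {n} n k)}
      (λ k → tame-Ψ (quotient n k) (remainder {n} n k))
      -- The bound concerns s + 1 because a star edge at a leaf a gets d a from the form and ε from
      -- the adjacency matrix, in total 1 + ε (s + 1).
      (∑ (bound ∘ tame-1+s)) (∑-nonNeg (0≤bound ∘ tame-1+s))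

  -- Opaque because unfolding the least upper bounds behind z is prohibitively slow.
  opaque
    ε : Carrier
    ε = Solution.ε

    ε≉0 : ε ≉ 0#
    ε≉0 = Solution.ε≉0

    z : Unknown
    z = Solution.fixedPoint

    z-fixed : ∀ i j → entry z i j ≈ ε * Ψ z i j
    z-fixed i j = trans (Solution.fixedPoint-fixed (combine i j))
      (*-congˡ (reflexive (≡.cong (λ (q , r) → Ψ z q r) (remQuot-combine i j))))

    1+ε[s+1]≉0 : ∀ k → 1# + ε * (s z k + 1#) ≉ 0#
    1+ε[s+1]≉0 k = Solution.1+ε*≉0
      (within-weaken (term≤∑ (0≤bound ∘ tame-1+s) k) (bounded (tame-1+s k) Solution.fixedPoint-box))

  d : Fin n → Carrier
  d k = J k + ε * s z k

  d+ε≉0 : ∀ {k} → p k ≢ k → d k + ε ≉ 0#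
  d+ε≉0 {k} pk≢k e = 1+ε[s+1]≉0 k (begin
      1# + ε * (s z k + 1#)    ≈⟨ solve 2 (λ ε s → :1 :+ ε :* (s :+ :1) := (:1 :+ ε :* s) :+ ε)
           refl ε (s z k) ⟩
      (1# + ε * s z k) + ε     ≈⟨ +-congʳ (+-congʳ (J-1 pk≢k)) ⟨
      d k + ε                  ≈⟨ e ⟩
      0#                       ∎)
    where open ≈-Reasoning

  M K A X : Mat
  M k l = δ k l * d k + ε * E′ k l
  K k l = δ k l * J k + ε * X₁ z k l
  A i j = ∑ (λ k → R k i * (d k * R k j)) + ε * E i j
  X = R⁻ ∙ K ∙ R⁻ ᵀ

  M∙K : M ∙ K ≋ δ
  M∙K i j = begin
    ∑ (λ k → M i k * K k j)
      ≈⟨ ∑-cong (λ k → solve 8 (λ δik Ji ε si e δkj Jk x →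
           (δik :* (Ji :+ ε :* si) :+ ε :* e) :* (δkj :* Jk :+ ε :* x)
             := (δik :* (Ji :* (δkj :* Jk :+ ε :* x)) :+ (ε :* (e :+ δik :* si) :* Jk) :* δkj) :+ ε :* ε :* ((e :+ δik :* si) :* x))
           refl (δ i k) (J i) ε (s z i) (E′ i k) (δ k j) (J k) (X₁ z k j)) ⟩
    ∑ (λ k → (δ i k * (J i * K k j) + (ε * F z i k * J k) * δ k j) + ε * ε * (F z i k * X₁ z k j))
      ≈⟨ ∑-distrib-+ (λ k → δ i k * (J i * K k j) + (ε * F z i k * J k) * δ k j) (λ k → ε * ε * (F z i k * X₁ z k j)) ⟩
    ∑ (λ k → δ i k * (J i * K k j) + (ε * F z i k * J k) * δ k j) + ∑ (λ k → ε * ε * (F z i k * X₁ z k j))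
      ≈⟨ +-cong (∑-distrib-+ (λ k → δ i k * (J i * K k j)) (λ k → (ε * F z i k * J k) * δ k j))
                (sym (*-distribˡ-∑ (ε * ε) (λ k → F z i k * X₁ z k j))) ⟩
    (∑ (λ k → δ i k * (J i * K k j)) + ∑ (λ k → (ε * F z i k * J k) * δ k j)) + ε * ε * FX
      ≈⟨ +-congʳ (+-cong (∑-δˡ i (λ k → J i * K k j)) (∑-δʳ j (λ k → ε * F z i k * J k))) ⟩
    (J i * (δ i j * J i + ε * (- (J i * F z i j * J j) - entry z i j)) + ε * F z i j * J j) + ε * ε * FX
      -- The fixed-point equation enters here; afterwards the terms in ε and in ε² cancel by J² = 1.
      ≈⟨ +-congʳ (+-congʳ (*-congˡ (+-congˡ (*-congˡ (+-congˡ (-‿cong (z-fixed i j))))))) ⟩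
    (J i * (δ i j * J i + ε * (- (J i * F z i j * J j) - ε * (J i * FX))) + ε * F z i j * J j) + ε * ε * FX
      ≈⟨ solve 6 (λ Ji d ε f Jj x →
           (Ji :* (d :* Ji :+ ε :* (:- (Ji :* f :* Jj) :- ε :* (Ji :* x))) :+ ε :* f :* Jj) :+ ε :* ε :* x
             := Ji :* Ji :* (d :- ε :* f :* Jj :- ε :* ε :* x) :+ (ε :* f :* Jj :+ ε :* ε :* x))
           refl (J i) (δ i j) ε (F z i j) (J j) FX ⟩
    J i * J i * (δ i j - ε * F z i j * J j - ε * ε * FX) + (ε * F z i j * J j + ε * ε * FX)
      ≈⟨ +-congʳ (*-congʳ (J² i)) ⟩
    1# * (δ i j - ε * F z i j * J j - ε * ε * FX) + (ε * F z i j * J j + ε * ε * FX)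
      ≈⟨ solve 3 (λ d x y → :1 :* (d :- x :- y) :+ (x :+ y) := d)
           refl (δ i j) (ε * F z i j * J j) (ε * ε * FX) ⟩
    δ i j ∎
    where
    open ≈-Reasoning
    FX = (F z ∙ X₁ z) i j

  A≋RᵀMR : A ≋ R ᵀ ∙ (M ∙ R)
  A≋RᵀMR i j = begin
    ∑ (λ k → R k i * (d k * R k j)) + ε * E i j
      ≈⟨ +-congˡ (*-congˡ (RᵀE′R i j)) ⟨
    ∑ (λ k → R k i * (d k * R k j)) + ε * ∑ (λ k → R k i * (E′ ∙ R) k j)
      ≈⟨ +-congˡ (*-distribˡ-∑ ε (λ k → R k i * (E′ ∙ R) k j)) ⟩
    ∑ (λ k → R k i * (d k * R k j)) + ∑ (λ k → ε * (R k i * (E′ ∙ R) k j))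
      ≈⟨ ∑-distrib-+ (λ k → R k i * (d k * R k j)) (λ k → ε * (R k i * (E′ ∙ R) k j)) ⟨
    ∑ (λ k → R k i * (d k * R k j) + ε * (R k i * (E′ ∙ R) k j))
      ≈⟨ ∑-cong (λ k → solve 4 (λ r a ε b → r :* a :+ ε :* (r :* b) := r :* (a :+ ε :* b))
           refl (R k i) (d k * R k j) ε ((E′ ∙ R) k j)) ⟩
    ∑ (λ k → R k i * (d k * R k j + ε * (E′ ∙ R) k j))
      ≈⟨ ∑-cong (λ k → *-congˡ (M∙R k)) ⟨
    ∑ (λ k → R k i * (M ∙ R) k j) ∎
    where
    open ≈-Reasoning
    M∙R : ∀ k → (M ∙ R) k j ≈ d k * R k j + ε * (E′ ∙ R) k j
    M∙R k = begin
      ∑ (λ l → M k l * R l j)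
        ≈⟨ ∑-cong (λ l → solve 5 (λ δkl dk ε e r → (δkl :* dk :+ ε :* e) :* r := δkl :* (dk :* r) :+ ε :* (e :* r))
             refl (δ k l) (d k) ε (E′ k l) (R l j)) ⟩
      ∑ (λ l → δ k l * (d k * R l j) + ε * (E′ k l * R l j))
        ≈⟨ ∑-distrib-+ (λ l → δ k l * (d k * R l j)) (λ l → ε * (E′ k l * R l j)) ⟩
      ∑ (λ l → δ k l * (d k * R l j)) + ∑ (λ l → ε * (E′ k l * R l j))
        ≈⟨ +-cong (∑-δˡ k (λ l → d k * R l j)) (sym (*-distribˡ-∑ ε (λ l → E′ k l * R l j))) ⟩
      d k * R k j + ε * (E′ ∙ R) k j ∎

  A∙X : A ∙ X ≋ δ
  A∙X = begin
    A ∙ X                                        ≈⟨ ∙-congʳ X A≋RᵀMR ⟩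
    R ᵀ ∙ (M ∙ R) ∙ (R⁻ ∙ K ∙ R⁻ ᵀ)              ≈⟨ ∙-assoc (R ᵀ) (M ∙ R) (R⁻ ∙ K ∙ R⁻ ᵀ) ⟩
    R ᵀ ∙ (M ∙ R ∙ (R⁻ ∙ K ∙ R⁻ ᵀ))              ≈⟨ ∙-congˡ (R ᵀ) (∙-assoc (M ∙ R) (R⁻ ∙ K) (R⁻ ᵀ)) ⟨
    R ᵀ ∙ (M ∙ R ∙ (R⁻ ∙ K) ∙ R⁻ ᵀ)              ≈⟨ ∙-congˡ (R ᵀ) (∙-congʳ (R⁻ ᵀ) middle) ⟩
    R ᵀ ∙ (δ ∙ R⁻ ᵀ)                             ≈⟨ ∙-congˡ (R ᵀ) (∙-identityˡ (R⁻ ᵀ)) ⟩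
    R ᵀ ∙ R⁻ ᵀ                                   ≈⟨ Rᵀ∙R⁻ᵀ ⟩
    δ                                            ∎
    where
    open ≋-Reasoning
    middle : M ∙ R ∙ (R⁻ ∙ K) ≋ δ
    middle = begin
      M ∙ R ∙ (R⁻ ∙ K)      ≈⟨ ∙-assoc M R (R⁻ ∙ K) ⟩
      M ∙ (R ∙ (R⁻ ∙ K))    ≈⟨ ∙-congˡ M (∙-assoc R R⁻ K) ⟨
      M ∙ (R ∙ R⁻ ∙ K)      ≈⟨ ∙-congˡ M (∙-congʳ K R∙R⁻) ⟩
      M ∙ (δ ∙ K)           ≈⟨ ∙-congˡ M (∙-identityˡ K) ⟩
      M ∙ K                 ≈⟨ M∙K ⟩
      δ                     ∎

  X-leafEntry : ∀ {a} → p a ≢ a → X a a ≈ leafEntry K a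
  X-leafEntry {a} pa≢a = begin
    ∑ (λ k → (R⁻ ∙ K) a k * R⁻ a k)    ≈⟨ ∑-cong (λ k → *-comm _ _) ⟩
    ∑ (λ k → R⁻ a k * (R⁻ ∙ K) a k)    ≈⟨ R⁻-apply-leaf (λ k → (R⁻ ∙ K) a k) ⟩
    (R⁻ ∙ K) a a - (R⁻ ∙ K) a (p a)    ≈⟨ +-cong (R⁻-apply-leaf (λ k → K k a)) (-‿cong (R⁻-apply-leaf (λ k → K k (p a)))) ⟩
    (K a a - K (p a) a) - (K a (p a) - K (p a) (p a))
      ≈⟨ solve 4 (λ x y u v → (x :- y) :- (u :- v) := (x :- u) :- (y :- v))
           refl (K a a) (K (p a) a) (K a (p a)) (K (p a) (p a)) ⟩
    leafEntry K a ∎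
    where
    open ≈-Reasoning
    R⁻-apply-leaf : ∀ f → ∑ (λ k → R⁻ a k * f k) ≈ f a - f (p a)
    R⁻-apply-leaf f = trans (R⁻-apply a f) (+-congˡ (-‿cong (trans (*-congʳ (leaf-1 pa≢a)) (*-identityˡ _))))

  -- The entry is the value of the form K at e_a - e_(p a). Its constant part is J a + J (p a) = 1 -
  -- 1, and its part in ε vanishes by the choice of `s`.
  X-leaf : ∀ {a} → p a ≢ a → X a a ≈ 0#
  X-leaf {a} pa≢a = begin
    X a a
      ≈⟨ X-leafEntry pa≢a ⟩
    (δ a a * J a + ε * X₁ z a a - (δ a q * J a + ε * X₁ z a q)) - ((δ q a * J q + ε * X₁ z q a) - (δ q q * J q + ε * X₁ z q q))
      ≈⟨ +-cong (+-cong (+-cong (*-cong (δ-refl a) (J-1 pa≢a)) (*-congˡ X₁aa))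
                        (-‿cong (+-cong (*-congʳ (δ-≢ (pa≢a ∘ ≡.sym))) (*-congˡ (X₁-off (pa≢a ∘ ≡.sym))))))
                (-‿cong (+-cong (+-cong (*-congʳ (δ-≢ pa≢a)) (*-congˡ (X₁-off pa≢a)))
                                (-‿cong (+-cong (*-cong (δ-refl q) (J--1 (p-idem a))) (*-congˡ X₁qq))))) ⟩
    (1# * 1# + ε * (- Baa + (Baa - Baq - (Bqa - Bqq) + (zaa - zaq - (zqa - zqq))) - zaa) - (0# * J a + ε * (- Baq - zaq)))
      - ((0# * J q + ε * (- Bqa - zqa)) - (1# * - 1# + ε * (- Bqq - zqq)))
      ≈⟨ solve 11 (λ ε Ja Jq Baa Baq Bqa Bqq zaa zaq zqa zqq →
           (:1 :* :1 :+ ε :* (:- Baa :+ (Baa :- Baq :- (Bqa :- Bqq) :+ (zaa :- zaq :- (zqa :- zqq))) :- zaa) :- (:0 :* Ja :+ ε :* (:- Baq :- zaq)))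
             :- ((:0 :* Jq :+ ε :* (:- Bqa :- zqa)) :- (:1 :* :- :1 :+ ε :* (:- Bqq :- zqq))) := :0)
           refl ε (J a) (J q) Baa Baq Bqa Bqq zaa zaq zqa zqq ⟩
    0# ∎
    where
    open ≈-Reasoning
    q = p a
    B : Mat
    B i j = J i * E′ i j * J j
    Baa = B a a
    Baq = B a q
    Bqa = B q a
    Bqq = B q q
    zaa = entry z a a
    zaq = entry z a q
    zqa = entry z q a
    zqq = entry z q q
    X₁-off : ∀ {i j} → i ≢ j → X₁ z i j ≈ - B i j - entry z i j
    X₁-off {i} {j} i≢j = +-congʳ (-‿cong (*-congʳ (*-congˡ
      (trans (+-congˡ (trans (*-congʳ (δ-≢ i≢j)) (zeroˡ _))) (+-identityʳ _)))))
    X₁-diagonal : ∀ i → X₁ z i i ≈ - B i i - s z i - entry z i i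
    X₁-diagonal i = begin
      - (J i * (E′ i i + δ i i * s z i) * J i) - entry z i i
        ≈⟨ +-congʳ (-‿cong (*-congʳ (*-congˡ (+-congˡ (*-congʳ (δ-refl i)))))) ⟩
      - (J i * (E′ i i + 1# * s z i) * J i) - entry z i i
        ≈⟨ solve 4 (λ Ji e s z → :- (Ji :* (e :+ :1 :* s) :* Ji) :- z := :- (Ji :* e :* Ji) :- Ji :* Ji :* s :- z)
             refl (J i) (E′ i i) (s z i) (entry z i i) ⟩
      - B i i - J i * J i * s z i - entry z i i
        ≈⟨ +-congʳ (+-congˡ (-‿cong (trans (*-congʳ (J² i)) (*-identityˡ _)))) ⟩
      - B i i - s z i - entry z i i ∎
    X₁aa : X₁ z a a ≈ - Baa + (Baa - Baq - (Bqa - Bqq) + (zaa - zaq - (zqa - zqq))) - zaa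
    X₁aa = trans (X₁-diagonal a) (+-congʳ (+-congˡ
      (trans (-‿cong (trans (*-congʳ (leaf-1 pa≢a)) (*-identityˡ _))) (solve 1 (λ x → :- :- x := x)
           refl _))))
    X₁qq : X₁ z q q ≈ - Bqq - zqq
    X₁qq = trans (X₁-diagonal q) (+-congʳ
      (trans (+-congˡ (-‿cong (trans (*-congʳ (leaf-0 (p-idem a))) (zeroˡ _))))
             (solve 1 (λ x → x :- :0 := x) refl _)))

  A-sym : (∀ i j → E i j ≈ E j i) → ∀ i j → A j i ≈ A i j
  A-sym E-sym i j = +-cong
    (∑-cong λ k → solve 3 (λ x y z → x :* (y :* z) := z :* (y :* x))
         refl (R k j) (d k) (R k i)) (*-congˡ (E-sym j i))

  -- Row k of R is supported on k and p k, so the summand of k reaches the entry (i , j) only if k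
  -- is one of i, j and p k the other.
  A-offDiagonal : ∀ {i j} → i ≢ j →
    A i j ≈ (leaf i * δ (p i) j * d i + leaf j * δ (p j) i * d j) + ε * E i j
  A-offDiagonal {i} {j} i≢j = +-congʳ (begin
    ∑ (λ k → R k i * (d k * R k j))
      ≈⟨ ∑-cong expand ⟩
    ∑ (λ k → δ i k * (leaf k * δ (p k) j * d k) + δ j k * (leaf k * δ (p k) i * d k))
      ≈⟨ ∑-distrib-+ (λ k → δ i k * (leaf k * δ (p k) j * d k)) (λ k → δ j k * (leaf k * δ (p k) i * d k)) ⟩
    ∑ (λ k → δ i k * (leaf k * δ (p k) j * d k)) + ∑ (λ k → δ j k * (leaf k * δ (p k) i * d k))
      ≈⟨ +-cong (∑-δˡ i _) (∑-δˡ j _) ⟩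
    leaf i * δ (p i) j * d i + leaf j * δ (p j) i * d j ∎)
    where
    open ≈-Reasoning
    δδ≈0 : ∀ k → δ k i * δ k j ≈ 0#
    δδ≈0 k with k ≟ i
    ... | yes ≡.refl = trans (*-congˡ (δ-≢ i≢j)) (zeroʳ _)
    ... | no _       = zeroˡ _
    expand : ∀ k → R k i * (d k * R k j) ≈ δ i k * (leaf k * δ (p k) j * d k) + δ j k * (leaf k * δ (p k) i * d k)
    expand k = begin
      (δ k i + leaf k * δ (p k) i) * (d k * (δ k j + leaf k * δ (p k) j))
        ≈⟨ solve 6 (λ x u y d w v → (x :+ u :* y) :* (d :* (w :+ u :* v))
             := (x :* (u :* v :* d) :+ w :* (u :* y :* d)) :+ (x :* w :+ u :* u :* (y :* v)) :* d) refl
             (δ k i) (leaf k) (δ (p k) i) (d k) (δ k j) (δ (p k) j) ⟩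
      (δ k i * (leaf k * δ (p k) j * d k) + δ k j * (leaf k * δ (p k) i * d k)) + (δ k i * δ k j + leaf k * leaf k * (δ (p k) i * δ (p k) j)) * d k
        ≈⟨ +-cong (+-cong (*-congʳ (δ-sym k i)) (*-congʳ (δ-sym k j))) (*-congʳ (+-cong (δδ≈0 k) (*-congˡ (δδ≈0 (p k))))) ⟩
      (δ i k * (leaf k * δ (p k) j * d k) + δ j k * (leaf k * δ (p k) i * d k)) + (0# + leaf k * leaf k * 0#) * d k
        ≈⟨ solve 3 (λ x u d → x :+ (:0 :+ u :* :0) :* d := x) refl _ _ _ ⟩
      δ i k * (leaf k * δ (p k) j * d k) + δ j k * (leaf k * δ (p k) i * d k) ∎

  A-starEdge : ∀ {a} → p a ≢ a → E a (p a) ≈ 1# → A a (p a) ≉ 0#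
  A-starEdge {a} pa≢a E≈1 A≈0 = d+ε≉0 pa≢a (begin
    d a + ε
      ≈⟨ solve 4 (λ d ε x y → d :+ ε := (:1 :* :1 :* d :+ :0 :* x :* y) :+ ε :* :1)
           refl (d a) ε (δ (p q) a) (d q) ⟩
    (1# * 1# * d a + 0# * δ (p q) a * d q) + ε * 1#
      ≈⟨ +-cong (+-cong (*-congʳ (*-cong (leaf-1 pa≢a) (δ-refl q))) (*-congʳ (*-congʳ (leaf-0 (p-idem a))))) (*-congˡ E≈1) ⟨
    (leaf a * δ q q * d a + leaf q * δ (p q) a * d q) + ε * E a q
      ≈⟨ A-offDiagonal (pa≢a ∘ ≡.sym) ⟨
    A a q
      ≈⟨ A≈0 ⟩
    0# ∎)
    where
    open ≈-Reasoning
    q = p a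

  A-otherEdge : ∀ {i j} → i ≢ j → p i ≢ j → p j ≢ i → A i j ≈ ε * E i j
  A-otherEdge {i} {j} i≢j pi≢j pj≢i = trans (A-offDiagonal i≢j) (trans
    (+-congʳ (+-cong (*-congʳ (*-congˡ (δ-≢ pi≢j))) (*-congʳ (*-congˡ (δ-≢ pj≢i)))))
    (solve 5 (λ u d v e x → (u :* :0 :* d :+ v :* :0 :* e) :+ x := x)
         refl (leaf i) (d i) (leaf j) (d j) (ε * E i j)))

-- Maximal independent sets and least witnesses.

maximalIndependentSet : ExcludedMiddle 0ℓ → ∀ {n} (_~_ : Rel (Fin n) 0ℓ) →
  Symmetric _~_ → Irreflexive _≡_ _~_ →
  Σ[ c ∈ (Fin n → Bool) ] (∀ {i j} → c i ≡ true → c j ≡ true → ¬ i ~ j) × (∀ i → c i ≡ false → ∃[ j ] i ~ j × c j ≡ true)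
maximalIndependentSet em {zero}  _~_ ~-sym ~-irrefl = (λ ()) , (λ { {()} }) , λ ()
maximalIndependentSet em {suc n} _~_ ~-sym ~-irrefl
  with maximalIndependentSet em (λ i j → suc i ~ suc j) ~-sym (λ { ≡.refl → ~-irrefl ≡.refl })
-- Greedy choice: vertex 0 joins the set found among the other vertices exactly when it has no
-- neighbour there.
... | c , independent , maximal with em {∃[ j ] zero ~ suc j × c j ≡ true}
...   | yes (j , 0~j , cⱼ) = c′ , independent′ , maximal′
  where
  c′ : Fin (suc n) → Bool
  c′ zero    = false
  c′ (suc i) = c i
  independent′ : ∀ {i j} → c′ i ≡ true → c′ j ≡ true → ¬ i ~ j
  independent′ {suc i} {suc j} = independent
  maximal′ : ∀ i → c′ i ≡ false → ∃[ j ] i ~ j × c′ j ≡ true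
  maximal′ zero    _  = suc j , 0~j , cⱼ
  maximal′ (suc i) cᵢ with maximal i cᵢ
  ... | k , i~k , cₖ = suc k , i~k , cₖ
...   | no ∄ = c′ , independent′ , maximal′
  where
  c′ : Fin (suc n) → Bool
  c′ zero    = true
  c′ (suc i) = c i
  independent′ : ∀ {i j} → c′ i ≡ true → c′ j ≡ true → ¬ i ~ j
  independent′ {zero}  {zero}  _  _  0~0 = ~-irrefl ≡.refl 0~0
  independent′ {zero}  {suc j} _  cⱼ 0~j = ∄ (j , 0~j , cⱼ)
  independent′ {suc i} {zero}  cᵢ _  i~0 = ∄ (i , ~-sym i~0 , cᵢ)
  independent′ {suc i} {suc j} = independent
  maximal′ : ∀ i → c′ i ≡ false → ∃[ j ] i ~ j × c′ j ≡ true
  maximal′ (suc i) cᵢ with maximal i cᵢ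
  ... | k , i~k , cₖ = suc k , i~k , cₖ

-- A small cover only bounds the covering number; its exact value has to be exhibited as a minimum.
least : ExcludedMiddle 0ℓ → (P : ℕ → Set) → ∀ {k b} → k ℕ.≤ b → P k →
        ∃[ m ] m ℕ.≤ b × P m × (∀ l → P l → m ℕ.≤ l)
least em P {zero}  {b}     k≤b       pk = 0 , z≤n , pk , λ _ _ → z≤n
least em P {suc k} {suc b} (s≤s k≤b) pk with em {P 0}
... | yes p0 = 0 , z≤n , p0 , λ _ _ → z≤n
... | no ¬p0 with least em (P ∘ suc) k≤b pk
...   | m , m≤b , pm , m-least = suc m , s≤s m≤b , pm , λ
        { zero    p0 → contradiction p0 ¬p0
        ; (suc l) pl → s≤s (m-least l pl) }

-- Matrices with the prescribed graph, and covers made from them.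

module _ (em : ExcludedMiddle 0ℓ) (ℝ : CompleteOrderedField) {n : ℕ} (G : Graph (suc n)) where
  open OrderedField ℝ
  open InverseCriterion em ℝ

  record ZeroDiagonalInverse (A : SquareMatrix Carrier (suc n)) (c : Fin (suc n) → Bool) : Set where
    field
      X       : SquareMatrix Carrier (suc n)
      inverse : A ∙ X ≋ δ
      zeros   : ∀ i → c i ≡ true → X i i ≈ 0#

  open ZeroDiagonalInverse

  pVertex : ∀ {A c} → IsSymmetric ℝ A → ZeroDiagonalInverse A c → ∀ i → c i ≡ true → IsPVertex ℝ A i
  pVertex {A} A-sym Z i cᵢ = inverseDiagonal≈0⇒PVertex A (X Z) (inverse Z)
    (symmetric-inverse {A = A} A-sym (inverse Z)) i (zeros Z i cᵢ)

  HasOppositeNeighbours : (Fin (suc n) → Bool) → Set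
  HasOppositeNeighbours c = ∀ i → c i ≡ true → ∃[ j ] Adj G i j × c j ≡ false

  -- Vertices of colour `true` become leaves. The support is right because a star edge carries d +
  -- ε, every other edge carries ε, and a non-edge, which is never a star edge, carries 0.
  starMatrix : ∀ c → HasOppositeNeighbours c →
               ∃[ A ] S ℝ G A × ZeroDiagonalInverse A c
  starMatrix c neighbour = A , (A-symmetric , λ i j → mk⇔ (edge⇐ i j) (edge⇒ i j)) , record
    { X       = SP.X
    ; inverse = SP.A∙X
    ; zeros   = λ i cᵢ → SP.X-leaf λ pᵢ≡i → true≢false (≡.trans (≡.sym cᵢ) (≡.trans (≡.cong c (≡.sym pᵢ≡i)) (c-p i)))
    }
    where
    true≢false : true ≢ false
    true≢false ()

    -- A vertex of colour `false` is its own centre, possibly of a star without leaves. Chosen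
    -- neighbours have colour `false`, which makes p idempotent.
    centre : ∀ i → ∃[ q ] c q ≡ false × (q ≢ i → Adj G i q) × (c i ≡ false → q ≡ i)
    centre i with c i in e
    ... | false = i , e , contradiction ≡.refl , λ _ → ≡.refl
    ... | true  = let q , i~q , c-q = neighbour i e in q , c-q , const i~q , λ ()

    p : Fin (suc n) → Fin (suc n)
    p i = proj₁ (centre i)

    c-p : ∀ i → c (p i) ≡ false
    c-p i = proj₁ (proj₂ (centre i))

    adj-p : ∀ {i} → p i ≢ i → Adj G i (p i)
    adj-p {i} = proj₁ (proj₂ (proj₂ (centre i)))

    p-idem : ∀ i → p (p i) ≡ p i
    p-idem i = proj₂ (proj₂ (proj₂ (centre (p i)))) (c-p i)

    E : SquareMatrix Carrier (suc n)
    E i j = if does (em {Adj G i j}) then 1# else 0#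

    E-1 : ∀ {i j} → Adj G i j → E i j ≈ 1#
    E-1 {i} {j} i~j with em {Adj G i j}
    ... | yes _   = refl
    ... | no ¬i~j = contradiction i~j ¬i~j

    E-0 : ∀ {i j} → ¬ Adj G i j → E i j ≈ 0#
    E-0 {i} {j} ¬i~j with em {Adj G i j}
    ... | yes i~j = contradiction i~j ¬i~j
    ... | no _    = refl

    E-sym : ∀ i j → E i j ≈ E j i
    E-sym i j with em {Adj G i j}
    ... | yes i~j = sym (E-1 (Graph.sym G i~j))
    ... | no ¬i~j = sym (E-0 (¬i~j ∘ Graph.sym G))

    module SP = StarPerturbation ℝ p p-idem E
    open SP using (A)

    A-symmetric : IsSymmetric ℝ A
    A-symmetric = SP.A-sym E-sym

    edge⇒ : ∀ i j → Adj G i j → i ≢ j × A i j ≉ 0#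
    edge⇒ i j i~j = i≢j , A≉0
      where
      i≢j : i ≢ j
      i≢j i≡j = Graph.irrefl G i≡j i~j
      A≉0 : A i j ≉ 0#
      A≉0 with p i ≟ j | p j ≟ i
      ... | yes ≡.refl | _          = SP.A-starEdge (i≢j ∘ ≡.sym) (E-1 i~j)
      ... | no _       | yes ≡.refl = λ A≈0 → SP.A-starEdge i≢j (E-1 (Graph.sym G i~j)) (trans (A-symmetric i j) A≈0)
      ... | no pᵢ≢j    | no pⱼ≢i    = λ A≈0 → SP.ε≉0 (begin
        SP.ε             ≈⟨ *-identityʳ _ ⟨
        SP.ε * 1#        ≈⟨ *-congˡ (E-1 i~j) ⟨
        SP.ε * E i j     ≈⟨ SP.A-otherEdge i≢j pᵢ≢j pⱼ≢i ⟨
        A i j            ≈⟨ A≈0 ⟩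
        0#               ∎)
        where open ≈-Reasoning

    edge⇐ : ∀ i j → i ≢ j × A i j ≉ 0# → Adj G i j
    edge⇐ i j (i≢j , A≉0) = decidable-stable em λ ¬i~j → A≉0 (trans
      (SP.A-otherEdge i≢j (¬i~j ∘ star i≢j) (¬i~j ∘ Graph.sym G ∘ star (i≢j ∘ ≡.sym)))
      (trans (*-congˡ (E-0 ¬i~j)) (zeroʳ _)))
      where
      star : ∀ {i j} → i ≢ j → p i ≡ j → Adj G i j
      star {i} i≢j pᵢ≡j = ≡.subst (Adj G i) pᵢ≡j (adj-p λ pᵢ≡i → i≢j (≡.trans (≡.sym pᵢ≡i) pᵢ≡j))

  -- A vertex of the set has some neighbour, which independence puts outside; a vertex outside has a
  -- neighbour in the set by maximality.
  twoSidedColouring : NoIsolatedVertices G →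
                      Σ[ c ∈ (Fin (suc n) → Bool) ] HasOppositeNeighbours c × HasOppositeNeighbours (not ∘ c)
  twoSidedColouring noIsolated
    with maximalIndependentSet em (Adj G) (Graph.sym G) (Graph.irrefl G)
  ... | c , independent , maximal = c , inside , outside
    where
    inside : HasOppositeNeighbours c
    inside i cᵢ = let j , i~j = noIsolated i in j , i~j , ¬-not (λ cⱼ → independent cᵢ cⱼ i~j)
    outside : HasOppositeNeighbours (not ∘ c)
    outside i ¬cᵢ = let j , i~j , cⱼ = maximal i (≡.trans (≡.sym (not-involutive (c i))) (≡.cong not ¬cᵢ))
                    in j , i~j , ≡.cong not cⱼ

  module _ {A A′ : SquareMatrix Carrier (suc n)} {c} (A∈S : S ℝ G A) (A′∈S : S ℝ G A′)
    (Z : ZeroDiagonalInverse A c) (Z′ : ZeroDiagonalInverse A′ (not ∘ c)) where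

    -- Members of a family must be distinct, so two coinciding matrices count once; the one matrix
    -- then has an inverse with zeros for either colour and covers everything.
    coverOfOne : A ≋ A′ → HasPVertexCover ℝ G 1
    coverOfOne A≋A′ = (λ _ → A) , record
      { distinct    = λ { {zero} {zero} _ → ≡.refl }
      ; inS         = λ _ → A∈S
      ; nonSingular = λ _ → rightInverse⇒det≉0 A (X Z) (inverse Z)
      ; covers      = λ i → zero , covered i (c i) ≡.refl
      }
      where
      Z″ : ZeroDiagonalInverse A (not ∘ c)
      Z″ = record
        { X       = X Z′
        ; inverse = λ i j → trans (∙-congʳ (X Z′) A≋A′ i j) (inverse Z′ i j)
        ; zeros   = zeros Z′
        }
      covered : ∀ i b → c i ≡ b → IsPVertex ℝ A i
      covered i true  cᵢ = pVertex (proj₁ A∈S) Z i cᵢ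
      covered i false cᵢ = pVertex (proj₁ A∈S) Z″ i (≡.cong not cᵢ)

    coverOfTwo : ¬ A ≋ A′ → HasPVertexCover ℝ G 2
    coverOfTwo A≉A′ = 𝒜 , record
      { distinct    = λ
          { {zero}     {zero}     _  → ≡.refl
          ; {zero}     {suc zero} eq → contradiction eq A≉A′
          ; {suc zero} {zero}     eq → contradiction (λ i j → sym (eq i j)) A≉A′
          ; {suc zero} {suc zero} _  → ≡.refl }
      ; inS         = λ { zero → A∈S ; (suc zero) → A′∈S }
      ; nonSingular = λ { zero       → rightInverse⇒det≉0 A (X Z) (inverse Z)
                        ; (suc zero) → rightInverse⇒det≉0 A′ (X Z′) (inverse Z′) }
      ; covers      = λ i → covered i (c i) ≡.refl
      }
      where
      𝒜 : Vector (Matrix ℝ (suc n)) 2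
      𝒜 zero       = A
      𝒜 (suc zero) = A′
      covered : ∀ i b → c i ≡ b → ∃[ a ] IsPVertex ℝ (𝒜 a) i
      covered i true  cᵢ = zero , pVertex (proj₁ A∈S) Z i cᵢ
      covered i false cᵢ = suc zero , pVertex (proj₁ A′∈S) Z′ i (≡.cong not cᵢ)

    coverOfAtMostTwo : Dec (A ≋ A′) → ∃[ k ] k ℕ.≤ 2 × HasPVertexCover ℝ G k
    coverOfAtMostTwo (yes A≋A′) = 1 , s≤s z≤n , coverOfOne A≋A′
    coverOfAtMostTwo (no A≉A′)  = 2 , s≤s (s≤s z≤n) , coverOfTwo A≉A′

  coverExists : NoIsolatedVertices G → ∃[ k ] k ℕ.≤ 2 × HasPVertexCover ℝ G k
  coverExists noIsolated = fromColouring (twoSidedColouring noIsolated)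
    where
    fromMatrices : ∀ {c} → (∃[ A ] S ℝ G A × ZeroDiagonalInverse A c) →
                   (∃[ A ] S ℝ G A × ZeroDiagonalInverse A (not ∘ c)) →
                   ∃[ k ] k ℕ.≤ 2 × HasPVertexCover ℝ G k
    fromMatrices (A , A∈S , Z) (A′ , A′∈S , Z′) = coverOfAtMostTwo A∈S A′∈S Z Z′ em
    fromColouring : (Σ[ c ∈ (Fin (suc n) → Bool) ] HasOppositeNeighbours c × HasOppositeNeighbours (not ∘ c)) →
                    ∃[ k ] k ℕ.≤ 2 × HasPVertexCover ℝ G k
    fromColouring (c , inside , outside) = fromMatrices (starMatrix c inside) (starMatrix (not ∘ c) outside)

theorem1 : ExcludedMiddle 0ℓ → (ℝ : CompleteOrderedField) →
    ∀ {n : ℕ} (G : Graph (suc n)) → NoIsolatedVertices G →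
    ∃[ p ] IsPVertexCoveringNumber ℝ G p × p ≤⁺ [ 2 ]
theorem1 em ℝ G noIsolated = fromCover (coverExists em ℝ G noIsolated)
  where
  fromLeast : (∃[ m ] m ℕ.≤ 2 × HasPVertexCover ℝ G m × (∀ l → HasPVertexCover ℝ G l → m ℕ.≤ l)) →
              ∃[ p ] IsPVertexCoveringNumber ℝ G p × p ≤⁺ [ 2 ]
  fromLeast (m , m≤2 , m-cover , m-least) = [ m ] , (m-cover , m-least) , ≤⁺.[ m≤2 ]
  fromCover : (∃[ k ] k ℕ.≤ 2 × HasPVertexCover ℝ G k) → ∃[ p ] IsPVertexCoveringNumber ℝ G p × p ≤⁺ [ 2 ]
  fromCover (k , k≤2 , cover) = fromLeast (least em (HasPVertexCover ℝ G) k≤2 cover)
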